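{- Let $n\geq 5$ be an integer. If $n$ is odd, then $$\operatorname{gr}_3(K_{1,3}:\widehat{K}_n)=\left\lfloor\frac{5n}{2}\right\rfloor,$$ and if $n$ is even, then $$\left\lfloor\frac{5n}{2}\right\rfloor-1\leq \operatorname{gr}_3(K_{1,3}:\widehat{K}_n)\leq \left\lfloor\frac{5n}{2}\right\rfloor.$$
   Context: The kipas $\widehat{K}_n$ is the graph on $n+1$ vertices obtained from the path $P_n$ on $n$ vertices by adding a new vertex (the center) adjacent to all vertices of the path. $K_{1,3}$ is the star with three edges. For graphs $G,H$ and a positive integer $k$, the Gallai-Ramsey number $\operatorname{gr}_k(G:H)$ is the minimum integer $N$ such that for every $n'\geq N$, every exact $k$-edge-coloring of the complete graph $K_{n'}$ (an edge-coloring in which exactly $k$ colors are used) contains either a rainbow copy of $G$ (a copy all of whose edges have pairwise distinct colors) or a monochromatic copy of $H$ (a copy all of whose edges have the same color). Copies are subgraphs, not necessarily induced; edge-colorings are not required to be proper. -}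

module Defs where

open import Level using (0ℓ)
open import Data.Nat using (ℕ; suc; _≤_)
open import Data.Nat.Properties using (1+n≢n)
open import Data.Fin using (Fin; zero; suc; toℕ)
open import Data.Product using (_×_; ∃; ∃-syntax)
open import Data.Sum using (_⊎_; inj₁; inj₂; swap)
open import Data.Empty using (⊥)
open import Function.Bundles using (_↣_; module Injection)
open import Relation.Binary.Core using (Rel)
open import Relation.Binary.Definitions using (Symmetric; Irreflexive)
open import Relation.Binary.PropositionalEquality using (_≡_; _≢_; refl)

record Graph : Set₁ where
  field
    order  : ℕ
    Adj    : Rel (Fin order) 0ℓ
    sym    : Symmetric Adj
    irrefl : Irreflexive _≡_ Adj

open Graph using (order; Adj)

edgeless : ℕ → Graph
edgeless n = record
  { order  = n
  ; Adj    = λ _ _ → ⊥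
  ; sym    = λ ()
  ; irrefl = λ _ ()
  }

path : ℕ → Graph
path n = record
  { order  = n
  ; Adj    = λ i j → suc (toℕ i) ≡ toℕ j ⊎ suc (toℕ j) ≡ toℕ i
  ; sym    = swap
  ; irrefl = λ { refl (inj₁ e) → 1+n≢n e ; refl (inj₂ e) → 1+n≢n e }
  }

-- The cone over G has the new vertex zero; the vertex v of G becomes suc v.
data ConeAdj (G : Graph) : Rel (Fin (suc (order G))) 0ℓ where
  center-base : ∀ v → ConeAdj G zero (suc v)
  base-center : ∀ v → ConeAdj G (suc v) zero
  base-base   : ∀ {u v} → Adj G u v → ConeAdj G (suc u) (suc v)

cone : Graph → Graph
cone G = record
  { order  = suc (order G)
  ; Adj    = ConeAdj G
  ; sym    = λ { (center-base v) → base-center v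
               ; (base-center v) → center-base v
               ; (base-base e)   → base-base (Graph.sym G e) }
  ; irrefl = λ { refl (base-base e) → Graph.irrefl G refl e }
  }

star : ℕ → Graph
star m = cone (edgeless m)

kipas : ℕ → Graph
kipas n = cone (path n)

-- An edge-coloring of the complete graph on Fin m with palette Fin k (k ≥ 1).
-- The values color i i are meaningless: every notion below only looks at
-- color i j for i ≢ j.
record Coloring (k m : ℕ) : Set where
  field
    color     : Fin m → Fin m → Fin k
    color-sym : ∀ i j → color i j ≡ color j i

open Coloring using (color)

Exact : ∀ {k m} → Coloring k m → Set
Exact {k} {m} χ = (c : Fin k) → ∃[ i ] ∃[ j ] (i ≢ j × color χ i j ≡ c)

-- In a complete host graph every injection of vertices is a (not necessarily
-- induced) copy.
Copy : Graph → ℕ → Set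
Copy G m = Fin (order G) ↣ Fin m

module _ {k m : ℕ} (χ : Coloring k m) (G : Graph) where

  edgeColor : Copy G m → Fin (order G) → Fin (order G) → Fin k
  edgeColor φ u v = color χ (Injection.to φ u) (Injection.to φ v)

  -- Edges uv and xy of the same color coincide as unordered pairs.
  Rainbow : Copy G m → Set
  Rainbow φ = ∀ {u v x y} → Adj G u v → Adj G x y →
    edgeColor φ u v ≡ edgeColor φ x y →
    (u ≡ x × v ≡ y) ⊎ (u ≡ y × v ≡ x)

  Monochromatic : Copy G m → Set
  Monochromatic φ = ∃[ c ] (∀ {u v} → Adj G u v → edgeColor φ u v ≡ c)

GallaiRamseyBound : ℕ → Graph → Graph → ℕ → Set
GallaiRamseyBound k G H N =
  ∀ m → N ≤ m → (χ : Coloring k m) → Exact χ →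
  ∃ (Rainbow χ G) ⊎ ∃ (Monochromatic χ H)

IsMinimum : (ℕ → Set) → ℕ → Set
IsMinimum P N = P N × (∀ M → P M → N ≤ M)

-- IsGallaiRamseyNumber k G H N means gr_k(G : H) = N.
IsGallaiRamseyNumber : ℕ → Graph → Graph → ℕ → Set
IsGallaiRamseyNumber k G H = IsMinimum (GallaiRamseyBound k G H)

{-# OPTIONS --safe #-}
module Submission where

-- Without a rainbow K₁,₃ every vertex misses a colour. Grouping the vertices by
-- a missing colour gives classes A, B, C of sizes a ≥ b ≥ c such that the edges
-- between two classes all have the colour missing at neither of them, and
-- exactness makes b positive. Put h = ⌊n/2⌋ and suppose there is no monochromatic
-- kipas. If b ≥ ⌈n/2⌉, the join of a colour neighbourhood inside A with B has a
-- large minimum degree in that colour, and Dirac's rotation argument finds a path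
-- on n vertices in the neighbourhood of a vertex. If b < ⌈n/2⌉, then a is so large
-- that Ramsey's theorem for paths applies: to A itself when C is nonempty, and
-- to the neighbourhoods inside A when C is empty.
-- For the lower bound, a clique of colour 2 on n vertices is joined in colour 0
-- to three cliques of colour 0 on at most h vertices, between which the colour is 1.
-- For even n this leaves two candidates for the number, and which of them it is
-- can be decided because there are finitely many colourings of given order.

open import Defs
open import Level using (0ℓ)
import Algebra.Solver.CommutativeMonoid as CommutativeMonoidSolver
open import Data.Empty using (⊥)
open import Data.Fin using
  (Fin; zero; suc; toℕ; finToFun; funToFin; splitAt; remQuot; combine; inject≤; fromℕ<; punchOut; _↑ˡ_; _↑ʳ_)
open import Data.Fin.Properties using
  (all?; any?; ¬∀⟶∃¬; injective⇒≤; toℕ<n; toℕ-injective; toℕ-fromℕ<; fromℕ<-injective; toℕ-inject≤; inject≤-injective;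
   finToFun-funToFin; splitAt-↑ˡ; splitAt-↑ʳ; splitAt⁻¹-↑ˡ; splitAt⁻¹-↑ʳ; combine-remQuot; remQuot-combine; toℕ-combine;
   combine-injective; punchOut-injective)
  renaming (_≟_ to _≟ᶠ_; suc-injective to sucᶠ-injective)
open import Data.List.Base using (List; []; _∷_; [_]; _++_; length; filter; reverse; take; drop; allFin; lookup)
open import Data.Nat using
  (ℕ; zero; suc; _≤_; _<_; z≤n; s≤s; s≤s⁻¹; _+_; _*_; _∸_; _^_; _/_; _%_; ⌊_/2⌋; ⌈_/2⌉; _≤?_)
open import Data.Nat.DivMod using (+-distrib-/-∣ʳ; m*n/n≡m; m≡m%n+[m/n]*n; m%n<n)
open import Data.Nat.Divisibility using (_∣_; _∤_; divides-refl)
open import Data.Nat.Properties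
open import Data.Nat.Tactic.RingSolver using (solve; solve-∀)
open import Data.Product using (_×_; _,_; proj₁; proj₂; ∃; ∃-syntax; Σ-syntax)
open import Data.Sum as Sum using (_⊎_; inj₁; inj₂)
open import Data.Sum.Properties using (inj₁-injective)
open import Function using (_∘_)
open import Function.Bundles using (mk↣; Injection)
open import Relation.Binary.Core using (Rel)
open import Relation.Binary.Definitions using (Symmetric; Decidable; DecidableEquality)
open import Relation.Binary.PropositionalEquality
  using (_≡_; _≢_; _≗_; refl; sym; trans; cong; cong₂; subst; subst₂; setoid; ≢-sym; module ≡-Reasoning)
open import Relation.Nullary using (¬_; Dec; yes; no; contradiction; ¬?)
open import Relation.Nullary.Decidable using (decidable-stable; map′; from-yes; _→-dec_; _⊎-dec_; _×-dec_)
open Graph using (order; Adj)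
open Coloring using (color; color-sym)

-- Arithmetic of the class sizes.

module ThreeSizes {n h : ℕ} (a b c : ℕ) (2h≤n : h + h ≤ n) (total : n + n + h ≤ a + b + c) where

  open ≤-Reasoning

  -- This and the next two lemmas serve the case of three classes with at least ⌈n/2⌉ vertices.
  -- There `x` is the degree of a vertex inside the largest class, and `d` inside the second, in the
  -- colour that joins these two classes. With `x` zero all sizes would be at most `h`, while the
  -- total is at least 5h.
  large⇒degree≥1 : ∀ {x} → 1 ≤ h → b ≤ a → c ≤ a → a ≤ x + h → 1 ≤ x
  large⇒degree≥1 {suc x} _ _ _ _ = s≤s z≤n
  large⇒degree≥1 {zero} 1≤h b≤a c≤a a≤h = contradiction (+-cancelʳ-≤ (h + h + h) 1 0 (begin
    1 + (h + h + h)          ≤⟨ +-monoˡ-≤ (h + h + h) (≤-trans 1≤h (m≤m+n h h)) ⟩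
    (h + h) + (h + h + h)    ≡⟨ solve (h ∷ []) ⟩
    (h + h) + (h + h) + h    ≤⟨ +-monoˡ-≤ h (+-mono-≤ 2h≤n 2h≤n) ⟩
    n + n + h                ≤⟨ total ⟩
    a + b + c                ≤⟨ +-mono-≤ (+-mono-≤ a≤h (≤-trans b≤a a≤h)) (≤-trans c≤a a≤h) ⟩
    h + h + h                ∎)) λ ()

  n≤x+b : ∀ {x} → a ≤ x + h → suc c ≤ h + h → n ≤ x + b
  n≤x+b {x} a≤ c< = +-cancelʳ-≤ (n + h) n (x + b) (begin
    n + (n + h)              ≡⟨ +-assoc n n h ⟨
    n + n + h                ≤⟨ total ⟩
    a + b + c                ≤⟨ +-mono-≤ (+-monoˡ-≤ b a≤) (≤-trans (n≤1+n c) (≤-trans c< 2h≤n)) ⟩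
    (x + h) + b + n          ≡⟨ solve (x ∷ h ∷ b ∷ n ∷ []) ⟩
    (x + b) + (n + h)        ∎)

  h≤x+d : ∀ {x d} → a ≤ x + h → b ≤ d + h → suc c ≤ h + h → h ≤ x + d
  h≤x+d {x} {d} a≤ b≤ c< = +-cancelʳ-≤ (n + n) h (x + d) (begin
    h + (n + n)                        ≡⟨ +-comm h (n + n) ⟩
    n + n + h                          ≤⟨ total ⟩
    a + b + c                          ≤⟨ +-mono-≤ (+-mono-≤ a≤ b≤) (≤-trans (n≤1+n c) c<) ⟩
    (x + h) + (d + h) + (h + h)        ≡⟨ solve (x ∷ h ∷ d ∷ []) ⟩
    (x + d) + ((h + h) + (h + h))      ≤⟨ +-monoʳ-≤ (x + d) (+-mono-≤ 2h≤n 2h≤n) ⟩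
    (x + d) + (n + n)                  ∎)

  -- The primed versions serve the case of exactly two large classes. There the bound `a ≤ x + h` is
  -- replaced by one that involves the small class as well, `a + c ≤ x + n`.
  large⇒degree≥1′ : ∀ {x} → 1 ≤ h → b ≤ a → a + c ≤ x + n → 1 ≤ x
  large⇒degree≥1′ {suc x} _ _ _ = s≤s z≤n
  large⇒degree≥1′ {zero} 1≤h b≤a a+c≤n = contradiction (+-cancelˡ-≤ (n + n) 1 0 (begin
    n + n + 1        ≤⟨ +-monoʳ-≤ (n + n) 1≤h ⟩
    n + n + h        ≤⟨ total ⟩
    a + b + c        ≤⟨ +-monoˡ-≤ c (+-monoʳ-≤ a b≤a) ⟩
    a + a + c        ≡⟨ +-assoc a a c ⟩
    a + (a + c)      ≤⟨ +-mono-≤ (≤-trans (m≤m+n a c) a+c≤n) a+c≤n ⟩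
    n + n            ≡⟨ +-identityʳ (n + n) ⟨
    n + n + 0        ∎)) λ ()

  n≤x+b′ : ∀ {x} → a + c ≤ x + n → n ≤ x + b
  n≤x+b′ {x} a+c≤ = +-cancelʳ-≤ n n (x + b) (begin
    n + n              ≤⟨ m≤m+n (n + n) h ⟩
    n + n + h          ≤⟨ total ⟩
    a + b + c          ≡⟨ solve (a ∷ b ∷ c ∷ []) ⟩
    (a + c) + b        ≤⟨ +-monoˡ-≤ b a+c≤ ⟩
    (x + n) + b        ≡⟨ solve (x ∷ n ∷ b ∷ []) ⟩
    (x + b) + n        ∎)

  h≤x+d′ : ∀ {x d} → a + c ≤ x + n → b + c ≤ d + n → h ≤ x + d
  h≤x+d′ {x} {d} a+c≤ b+c≤ = +-cancelʳ-≤ (n + n) h (x + d) (begin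
    h + (n + n)              ≡⟨ +-comm h (n + n) ⟩
    n + n + h                ≤⟨ total ⟩
    a + b + c                ≤⟨ +-monoʳ-≤ (a + b) (m≤m+n c c) ⟩
    a + b + (c + c)          ≡⟨ solve (a ∷ b ∷ c ∷ []) ⟩
    (a + c) + (b + c)        ≤⟨ +-mono-≤ a+c≤ b+c≤ ⟩
    (x + n) + (d + n)        ≡⟨ solve (x ∷ n ∷ d ∷ []) ⟩
    (x + d) + (n + n)        ∎)

  -- For the case of a single large class: `n + h` vertices suffice for the path Ramsey bound, and
  -- the `n + n` of the next lemma for `path⊎kipas`.
  n+h≤a : b ≤ h → c ≤ h → n + h ≤ a
  n+h≤a b≤h c≤h = +-cancelʳ-≤ n (n + h) a (begin
    n + h + n          ≡⟨ solve (n ∷ h ∷ []) ⟩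
    n + n + h          ≤⟨ total ⟩
    a + b + c          ≡⟨ +-assoc a b c ⟩
    a + (b + c)        ≤⟨ +-monoʳ-≤ a (≤-trans (+-mono-≤ b≤h c≤h) 2h≤n) ⟩
    a + n              ∎)

  n+n≤a : b ≤ h → c ≡ 0 → n + n ≤ a
  n+n≤a b≤h refl = +-cancelʳ-≤ h (n + n) a (begin
    n + n + h          ≤⟨ total ⟩
    a + b + 0          ≡⟨ +-identityʳ (a + b) ⟩
    a + b              ≤⟨ +-monoʳ-≤ a b≤h ⟩
    a + h              ∎)

open import Data.List.Properties using
  (length-++; filter-++; filter-all; unfold-reverse; length-reverse; length-filter; length-tabulate)
import Data.List.Membership.DecPropositional as DecMembership
open import Data.List.Membership.Propositional using (_∈_; _∉_; lose; find)
open import Data.List.Membership.Propositional.Properties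
  using (∈-∃++; ∈-filter⁺; ∈-filter⁻; ∈-++⁺ˡ; ∈-++⁺ʳ; ∈-++⁻; ∈-allFin; ∈-lookup)
open import Data.List.Relation.Binary.Permutation.Propositional
  using (_↭_; ↭-refl; ↭-sym; ↭-trans; ↭-prep; ↭-swap; ↭-reflexive; ↭⇒↭ₛ)
open import Data.List.Relation.Binary.Permutation.Propositional.Properties
  using (∈-resp-↭; ↭-length; ↭-reverse; shift; ++⁺ˡ; ++⁺ʳ; ++-comm; ++-commutativeMonoid)
import Data.List.Relation.Binary.Permutation.Setoid.Properties as Permutationₛ
open import Data.List.Relation.Binary.Subset.Propositional using (_⊆_)
open import Data.List.Relation.Unary.All as All using (All; []; _∷_)
open import Data.List.Relation.Unary.AllPairs using ([]; _∷_)
open import Data.List.Relation.Unary.Any as Any using (here; there)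
open import Data.List.Relation.Unary.Linked as Linked using (Linked; []; [-]; _∷_)
open import Data.List.Relation.Unary.Unique.Propositional using (Unique)
import Data.List.Relation.Unary.Unique.Propositional.Properties as Unique

-- Paths under degree conditions

n≤1+2⌊n/2⌋ : ∀ n → n ≤ suc (⌊ n /2⌋ + ⌊ n /2⌋)
n≤1+2⌊n/2⌋ zero          = z≤n
n≤1+2⌊n/2⌋ (suc zero)    = s≤s z≤n
n≤1+2⌊n/2⌋ (suc (suc n)) = s≤s (s≤s (≤-trans (n≤1+2⌊n/2⌋ n) (≤-reflexive (sym (+-suc _ _)))))

module _ {A : Set} where

  unique-⊆⇒length≤ : {xs ys : List A} → Unique xs → xs ⊆ ys → length xs ≤ length ys
  unique-⊆⇒length≤ [] _ = z≤n
  unique-⊆⇒length≤ {x ∷ xs} (x∉xs ∷ u) xs⊆ys with ∈-∃++ (xs⊆ys (here refl))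
  ... | us , vs , refl = begin
    suc (length xs)          ≤⟨ s≤s (unique-⊆⇒length≤ u xs⊆rest) ⟩
    suc (length (us ++ vs))  ≡⟨ ↭-length (↭-sym (shift x us vs)) ⟩
    length (us ++ x ∷ vs)    ∎
    where
    open ≤-Reasoning
    xs⊆rest : xs ⊆ us ++ vs
    xs⊆rest y∈xs with ∈-resp-↭ (shift x us vs) (xs⊆ys (there y∈xs))
    ... | here y≡x = contradiction (sym y≡x) (All.lookup x∉xs y∈xs)
    ... | there y∈ = y∈

  pick : (xs : List A) → 1 ≤ length xs → ∃[ x ] x ∈ xs
  pick (x ∷ _) _ = x , here refl

  search : {P : A → Set} → (∀ x → Dec (P x)) → ∀ xs → ∃[ x ] (x ∈ xs × P x) ⊎ (∀ {x} → x ∈ xs → ¬ P x)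
  search P? xs with Any.any? P? xs
  ... | yes a = inj₁ (find a)
  ... | no ¬a = inj₂ λ x∈ p → ¬a (lose x∈ p)

  collect : ∀ {X : Set} {P : A → Set} zs → (∀ {z} → z ∈ zs → X ⊎ P z) → X ⊎ (∀ {z} → z ∈ zs → P z)
  collect []       f = inj₂ λ ()
  collect (z ∷ zs) f with f (here refl) | collect zs (f ∘ there)
  ... | inj₁ x | _      = inj₁ x
  ... | _      | inj₁ x = inj₁ x
  ... | inj₂ p | inj₂ g = inj₂ λ { (here refl) → p ; (there z∈) → g z∈ }

  Unique-resp-↭ : {xs ys : List A} → xs ↭ ys → Unique xs → Unique ys
  Unique-resp-↭ p = Permutationₛ.Unique-resp-↭ (setoid A) (↭⇒↭ₛ p)

  Simple : List A → List A → Set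
  Simple S xs = Unique xs × xs ⊆ S

  simple-↭ : ∀ {S xs ys} → xs ↭ ys → Simple S xs → Simple S ys
  simple-↭ p (u , s) = Unique-resp-↭ p u , s ∘ ∈-resp-↭ (↭-sym p)

  simple-++ʳ : ∀ {S} xs {ys} → Simple S (xs ++ ys) → Simple S ys
  simple-++ʳ []       s             = s
  simple-++ʳ (x ∷ xs) (_ ∷ u , s) = simple-++ʳ xs (u , s ∘ there)

  simple-∷ : ∀ {S x xs} → x ∈ S → x ∉ xs → Simple S xs → Simple S (x ∷ xs)
  simple-∷ x∈S x∉xs (u , s) =
    All.tabulate (λ y∈xs x≡y → x∉xs (subst (_∈ _) (sym x≡y) y∈xs)) ∷ u ,
    λ { (here refl) → x∈S ; (there y∈) → s y∈ }

data Walk {V : Set} (E : Rel V 0ℓ) : V → List V → V → Set where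
  stop : ∀ x → Walk E x [ x ] x
  _∷_  : ∀ {x y z ys} → E x y → Walk E y ys z → Walk E x (x ∷ ys) z

module _ {V : Set} {E : Rel V 0ℓ} where

  glue : ∀ {x xs y z zs w} → Walk E x xs y → E y z → Walk E z zs w → Walk E x (xs ++ zs) w
  glue (stop _) e w  = e ∷ w
  glue (f ∷ v)  e w  = f ∷ glue v e w

  reverseWalk : Symmetric E → ∀ {x xs y} → Walk E x xs y → Walk E y (reverse xs) x
  reverseWalk E-sym (stop x) = stop x
  reverseWalk E-sym {x} (_∷_ {ys = ys} e w) =
    subst (λ l → Walk E _ l x) (sym (unfold-reverse x ys))
      (glue (reverseWalk E-sym w) (E-sym e) (stop x))

  starts : ∀ {x xs y} → Walk E x xs y → ∃[ ps ] xs ≡ x ∷ ps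
  starts (stop _) = [] , refl
  starts (_ ∷ _)  = _ , refl

  start∈ : ∀ {x xs y} → Walk E x xs y → x ∈ xs
  start∈ (stop _) = here refl
  start∈ (_ ∷ _)  = here refl

  starts≡ : ∀ {x y xs z w} → Walk E x xs z → Walk E y xs w → x ≡ y
  starts≡ (stop _) (stop _) = refl
  starts≡ (stop _) (_ ∷ ())
  starts≡ (_ ∷ ()) (stop _)
  starts≡ (_ ∷ _)  (_ ∷ _)  = refl

  splitWalk : ∀ {x xs y w} → Walk E x xs y → w ∈ xs →
    Walk E w xs y ⊎
    ∃[ us ] ∃[ p ] ∃[ vs ] (Walk E x us p × Walk E w vs y × xs ≡ us ++ vs)
  splitWalk v@(stop _) (here refl) = inj₁ v
  splitWalk v@(_ ∷ _)  (here refl) = inj₁ v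
  splitWalk (e ∷ v) (there w∈) with splitWalk v w∈
  ... | inj₁ v′ with refl ← starts≡ v v′ = inj₂ (_ , _ , _ , stop _ , v′ , refl)
  ... | inj₂ (us , p , vs , v₁ , v₂ , refl) = inj₂ (_ , p , vs , e ∷ v₁ , v₂ , refl)

  -- The edge from the end to the start closes the walk to a cycle, which is then opened just before
  -- `w`.
  rotateWalk : ∀ {x xs y w} → Walk E x xs y → E y x → w ∈ xs →
    ∃[ ys ] ∃[ z ] (Walk E w ys z × ys ↭ xs)
  rotateWalk {xs = xs} {y = y} v y~x w∈xs with splitWalk v w∈xs
  ... | inj₁ v′ = xs , y , v′ , ↭-refl
  ... | inj₂ (us , p , vs , v₁ , v₂ , refl) =
    vs ++ us , p , glue v₂ y~x v₁ , ++-comm vs us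

  takeWalk : ∀ k {x xs y} → Walk E x xs y → suc k ≤ length xs → ∃[ z ] Walk E x (take (suc k) xs) z
  takeWalk zero    (stop x) _ = x , stop x
  takeWalk zero    (_ ∷ _)  _ = _ , stop _
  takeWalk (suc k) (stop x) (s≤s ())
  takeWalk (suc k) (e ∷ w)  (s≤s k<) with takeWalk k w k<
  ... | z , w′ = z , e ∷ w′

record Path {V : Set} (E : Rel V 0ℓ) (S : List V) (k : ℕ) : Set where
  constructor mkPath
  field
    {start end} : V
    {verts}     : List V
    walk        : Walk E start verts end
    simple      : Simple S verts
    size        : length verts ≡ k

module _ {V : Set} {E : Rel V 0ℓ} where

  truncate : ∀ {S k l} → suc k ≤ l → Path E S l → Path E S (suc k)
  truncate {k = k} k<l (mkPath {verts = xs} w (u , s) refl) with takeWalk k w k<l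
  ... | _ , w′ = mkPath w′ (Unique.take⁺ (suc k) u , s ∘ take⊆ (suc k) xs) (length-take≤ (suc k) xs k<l)
    where
    take⊆ : ∀ k (xs : List V) → take k xs ⊆ xs
    take⊆ (suc k) (x ∷ xs) (here e)   = here e
    take⊆ (suc k) (x ∷ xs) (there y∈) = there (take⊆ k xs y∈)
    length-take≤ : ∀ k (xs : List V) → k ≤ length xs → length (take k xs) ≡ k
    length-take≤ zero    xs       _        = refl
    length-take≤ (suc k) (x ∷ xs) (s≤s k≤) = cong suc (length-take≤ k xs k≤)

  widen : ∀ {S T k} → S ⊆ T → Path E S k → Path E T k
  widen S⊆T (mkPath w (u , s) l) = mkPath w (u , S⊆T ∘ s) l

  extendAtStart : Symmetric E → ∀ {S k z} (P : Path E S k) → z ∈ S → z ∉ Path.verts P →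
    E (Path.start P) z → Path E S (suc k)
  extendAtStart E-sym (mkPath w s l) z∈S z∉ e = mkPath (E-sym e ∷ w) (simple-∷ z∈S z∉ s) (cong suc l)

  reversePath : Symmetric E → ∀ {S k} → Path E S k → Path E S k
  reversePath E-sym (mkPath {verts = xs} w s l) =
    mkPath (reverseWalk E-sym w) (simple-↭ (↭-sym (↭-reverse xs)) s) (trans (length-reverse xs) l)

module Difference {V : Set} (_≟_ : DecidableEquality V) where

  open DecMembership _≟_ public using (_∈?_)

  _∖_ : List V → List V → List V
  S ∖ T = filter (λ z → ¬? (z ∈? T)) S

  ∈-∖⁺ : ∀ {S T x} → x ∈ S → x ∉ T → x ∈ S ∖ T
  ∈-∖⁺ = ∈-filter⁺ _

  ∈-∖⁻ : ∀ {S} T {x} → x ∈ S ∖ T → x ∈ S × x ∉ T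
  ∈-∖⁻ T = ∈-filter⁻ (λ z → ¬? (z ∈? T))

  ∃-∖ : ∀ {S} T → Unique S → length T < length S → ∃[ x ] (x ∈ S × x ∉ T)
  ∃-∖ {S} T u lt with search (λ z → ¬? (z ∈? T)) S
  ... | inj₁ found = found
  ... | inj₂ none  = contradiction (unique-⊆⇒length≤ u λ {x} x∈S → decidable-stable (x ∈? T) (none x∈S)) (<⇒≱ lt)

  length-∖ : ∀ {S T} → Simple S T → Unique S → length T + length (S ∖ T) ≤ length S
  length-∖ {S} {T} (uT , T⊆S) uS = begin
    length T + length (S ∖ T)  ≡⟨ length-++ T ⟨
    length (T ++ S ∖ T)        ≤⟨ unique-⊆⇒length≤
      (Unique.++⁺ uT (Unique.filter⁺ _ uS) (λ (x∈T , x∈∖) → proj₂ (∈-∖⁻ {S} T x∈∖) x∈T)) sub ⟩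
    length S ∎
    where
    open ≤-Reasoning
    sub : T ++ S ∖ T ⊆ S
    sub x∈ with ∈-++⁻ T x∈
    ... | inj₁ x∈T = T⊆S x∈T
    ... | inj₂ x∈∖ = proj₁ (∈-∖⁻ {S} T x∈∖)

  length-∖-≥ : ∀ {S} T → Unique S → length S ≤ length T + length (S ∖ T)
  length-∖-≥ {S} T uS = begin
    length S              ≤⟨ unique-⊆⇒length≤ uS sub ⟩
    length (T ++ S ∖ T)   ≡⟨ length-++ T ⟩
    length T + length (S ∖ T) ∎
    where
    open ≤-Reasoning
    sub : S ⊆ T ++ S ∖ T
    sub {x} x∈S with x ∈? T
    ... | yes x∈T = ∈-++⁺ˡ x∈T
    ... | no  x∉T = ∈-++⁺ʳ T (∈-∖⁺ x∈S x∉T)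

module Dirac {V : Set} (_≟_ : DecidableEquality V)
             (E : Rel V 0ℓ) (E? : Decidable E) (E-sym : Symmetric E) (E-irr : ∀ {x} → ¬ E x x) where

  open Difference _≟_

  degree : V → List V → ℕ
  degree x S = length (filter (E? x) S)

  degree-⊆ : ∀ {x S T} → Unique S → (∀ {y} → y ∈ S → E x y → y ∈ T) → degree x S ≤ degree x T
  degree-⊆ {x} {S} u sub = unique-⊆⇒length≤ (Unique.filter⁺ (E? x) u)
    λ y∈ → let y∈S , e = ∈-filter⁻ (E? x) {xs = S} y∈ in ∈-filter⁺ (E? x) (sub y∈S e) e

  -- For `K` inside `S`: a union of connected components of the graph on `S`.
  Closed : List V → List V → Set
  Closed S K = ∀ {q z} → q ∈ K → z ∈ S → E q z → z ∈ K

  degree-drop : ∀ x {q vs y} → Walk E q vs y → degree x vs ≤ suc (degree x (drop 1 vs))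
  degree-drop x (stop q) = length-filter (E? x) [ q ]
  degree-drop x {q} (_∷_ {ys = vs} _ _) with E? x q
  ... | yes _ = ≤-refl
  ... | no  _ = n≤1+n _

  degree-drop-≁ : ∀ {x q vs y} → ¬ E x q → Walk E q vs y → degree x vs ≤ degree x (drop 1 vs)
  degree-drop-≁ {x} x≁q (stop q) with E? x q
  ... | yes x~q = contradiction x~q x≁q
  ... | no  _   = z≤n
  degree-drop-≁ {x} {q} x≁q (_ ∷ _) with E? x q
  ... | yes x~q = contradiction x~q x≁q
  ... | no  _   = ≤-refl

  -- The crossing pair p, q of Pósa's rotation: replacing the edge pq of the
  -- walk by the edges xq and yp makes a cycle on the vertices of the walk.
  Crossing : V → V → List V → V → Set
  Crossing x u us y = ∃[ vs ] ∃[ p ] ∃[ q ] ∃[ ws ]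
    (Walk E u vs p × Walk E q ws y × us ≡ vs ++ ws × E y p × E x q)

  lengthen : ∀ {x u q vs y} → E u q → Crossing x q vs y → Crossing x u (u ∷ vs) y
  lengthen u~q (_ , p , q′ , ws , v₁ , v₂ , eq , y~p , x~q′) =
    _ , p , q′ , ws , u~q ∷ v₁ , v₂ , cong (_ ∷_) eq , y~p , x~q′

  -- A pigeonhole argument along the walk: a step that does not cross contributes at most one to the
  -- sum of the two degrees, and the last vertex `y` contributes nothing because there are no loops.
  -- Without a crossing the sum would stay below the length.
  crossing : ∀ x {u us y} → Walk E u us y →
    length us ≤ degree x (drop 1 us) + degree y us → Crossing x u us y
  crossing x {y = y} (stop .y) le with E? y y
  ... | yes e = contradiction e E-irr
  ... | no _  = contradiction le λ ()
  crossing x {u} {us} {y} (_∷_ {y = q} u~q v) le with E? y u | E? x q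
  ... | yes y~u | yes x~q = _ , _ , _ , _ , stop u , v , refl , y~u , x~q
  ... | no  _   | _       = lengthen u~q (crossing x v (s≤s⁻¹ (≤-trans le (+-monoˡ-≤ _ (degree-drop x v)))))
  ... | yes _   | no x≁q  = lengthen u~q (crossing x v (s≤s⁻¹ (begin
    suc _        ≤⟨ le ⟩
    _ + suc _    ≤⟨ +-monoˡ-≤ _ (degree-drop-≁ x≁q v) ⟩
    _ + suc _    ≡⟨ +-suc _ _ ⟩
    _            ∎)))
    where open ≤-Reasoning

  degree-drop-self : ∀ {x xs y} → Walk E x xs y → degree x xs ≤ degree x (drop 1 xs)
  degree-drop-self w = degree-drop-≁ E-irr w

  module _ {S : List V} (uS : Unique S) {δ : ℕ} (δ≤deg : ∀ {x} → x ∈ S → δ ≤ degree x S) where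

    -- Let `z` off the path have a neighbour `q` on it. If neither end of the path has a neighbour
    -- outside, both ends have at least `δ` neighbours on it, which forces a crossing pair. The
    -- resulting cycle through all vertices of the path is opened at `q`, and `z` is put in front.
    extend : ∀ {k} (P : Path E S k) → k ≤ δ + δ → Path E S (suc k) ⊎ Closed S (Path.verts P)
    extend {k} P@(mkPath {x} {y} {xs} w s@(_ , xs⊆S) l) k≤2δ
      with search (λ z → Any.any? (λ q → E? q z) xs) (S ∖ xs)
    ... | inj₂ none = inj₂ closed
      where
      closed : Closed S xs
      closed {z = z} q∈ z∈S e = decidable-stable (z ∈? xs) λ z∉xs → none (∈-∖⁺ z∈S z∉xs) (lose q∈ e)
    ... | inj₁ (z , z∈∖ , a) with find a | ∈-∖⁻ {S} xs z∈∖ | search (E? x) (S ∖ xs) | search (E? y) (S ∖ xs)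
    ... | q , q∈xs , q~z | z∈S , z∉xs | inj₁ (z′ , z′∈ , x~z′) | _ =
      let z′∈S , z′∉xs = ∈-∖⁻ {S} xs z′∈ in inj₁ (extendAtStart E-sym P z′∈S z′∉xs x~z′)
    ... | q , q∈xs , q~z | z∈S , z∉xs | inj₂ _ | inj₁ (z′ , z′∈ , y~z′) =
      let z′∈S , z′∉xs = ∈-∖⁻ {S} xs z′∈ in
      inj₁ (extendAtStart E-sym (reversePath E-sym P) z′∈S (z′∉xs ∘ ∈-resp-↭ (↭-reverse xs)) y~z′)
    ... | q , q∈xs , q~z | z∈S , z∉xs | inj₂ x≁ | inj₂ y≁ = inj₁ (viaCycle (crossing x w enough))
      where
      inside : ∀ {u} → (∀ {v} → v ∈ S ∖ xs → ¬ E u v) → u ∈ S → δ ≤ degree u xs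
      inside u≁ u∈S = ≤-trans (δ≤deg u∈S) (degree-⊆ uS λ {v} v∈S u~v →
        decidable-stable (v ∈? xs) λ v∉ → u≁ (∈-∖⁺ v∈S v∉) u~v)
      end∈ : y ∈ xs
      end∈ = ∈-resp-↭ (↭-reverse xs) (start∈ (reverseWalk E-sym w))
      enough : length xs ≤ degree x (drop 1 xs) + degree y xs
      enough = begin
        length xs                         ≡⟨ l ⟩
        k                                 ≤⟨ k≤2δ ⟩
        δ + δ                             ≤⟨ +-mono-≤ (inside x≁ (xs⊆S (start∈ w))) (inside y≁ (xs⊆S end∈)) ⟩
        degree x xs + degree y xs         ≤⟨ +-monoˡ-≤ _ (degree-drop-self w) ⟩
        degree x (drop 1 xs) + degree y xs ∎
        where open ≤-Reasoning
      viaCycle : Crossing x x xs y → Path E S (suc k)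
      viaCycle (vs , p , q′ , ws , v₁ , v₂ , eq , y~p , x~q′) =
        let cycle↭ = ↭-trans (++⁺ˡ vs (↭-reverse ws)) (↭-reflexive (sym eq))
            ys , _ , v , ys↭ = rotateWalk (glue v₁ (E-sym y~p) (reverseWalk E-sym v₂)) (E-sym x~q′)
                                 (∈-resp-↭ (↭-sym cycle↭) q∈xs)
            perm = ↭-trans ys↭ cycle↭
        in mkPath (E-sym q~z ∷ v)
                  (simple-∷ z∈S (z∉xs ∘ ∈-resp-↭ perm) (simple-↭ (↭-sym perm) s))
                  (cong suc (trans (↭-length perm) l))

    ClosedPath : ℕ → Set
    ClosedPath n = ∃[ k ] (k < n × Σ[ P ∈ Path E S k ] Closed S (Path.verts P))

    -- Before the path reaches `n` vertices it has at most `δ + δ`, so `extend` applies. If the path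
    -- gets stuck, its vertices are a whole connected component of `S`.
    dirac : ∀ {n} s → s ∈ S → n ≤ suc (δ + δ) → 1 ≤ n → Path E S n ⊎ ClosedPath n
    dirac {suc n} s s∈S n≤ _ = grow n (+-comm n 1)
      (mkPath (stop s) ([] ∷ [] , λ { (here refl) → s∈S }) refl)
      where
      grow : ∀ d {k} → d + k ≡ suc n → Path E S k → Path E S (suc n) ⊎ ClosedPath (suc n)
      grow zero    refl P = inj₁ P
      grow (suc d) {k} eq P with extend P (≤-trans (subst (k ≤_) (suc-injective eq) (m≤n+m k d)) (s≤s⁻¹ n≤))
      ... | inj₁ P′ = grow d (trans (+-suc d k) eq) P′
      ... | inj₂ c  = inj₂ (k , subst (k <_) eq (s≤s (m≤n+m k d)) , P , c)

  degree<closed : ∀ {S K x} → Unique S → x ∈ K → Closed S K → degree x S < length K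
  degree<closed {S} {K} {x} uS x∈K c =
    unique-⊆⇒length≤ (All.tabulate x≢ ∷ Unique.filter⁺ (E? x) uS) sub
    where
    x≢ : ∀ {y} → y ∈ filter (E? x) S → x ≢ y
    x≢ y∈ refl = E-irr (proj₂ (∈-filter⁻ (E? x) {xs = S} y∈))
    sub : x ∷ filter (E? x) S ⊆ K
    sub (here refl) = x∈K
    sub (there y∈)  = let y∈S , e = ∈-filter⁻ (E? x) {xs = S} y∈ in c x∈K y∈S e

  closed-∖ : ∀ {S K} → K ⊆ S → Closed S K → Closed S (S ∖ K)
  closed-∖ {S} {K} K⊆S c q∈ z∈S q~z =
    let q∈S , q∉K = ∈-∖⁻ {S} K q∈ in ∈-∖⁺ z∈S λ z∈K → q∉K (c z∈K q∈S (E-sym q~z))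

  degree-∖-closed : ∀ {S K x} → Unique S → K ⊆ S → Closed S K → x ∈ S ∖ K → degree x S ≤ degree x (S ∖ K)
  degree-∖-closed uS K⊆S c x∈ = degree-⊆ uS λ y∈S e → closed-∖ K⊆S c x∈ y∈S e

  -- A component with fewer than `n` vertices leaves a nonempty closed complement. Each of the two
  -- contains a vertex with all its neighbours, hence at least `δ + 1` vertices, which is too many
  -- for `S`.
  dense⇒path : ∀ {S δ n} → Unique S → (∀ {x} → x ∈ S → δ ≤ degree x S) →
    1 ≤ n → n ≤ length S → length S ≤ suc (δ + δ) → Path E S n
  dense⇒path {S} {δ} {n} uS δ≤ 1≤n n≤ ≤2δ+1 with pick S (≤-trans 1≤n n≤)
  ... | s , s∈S with dirac uS δ≤ s s∈S (≤-trans n≤ ≤2δ+1) 1≤n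
  ... | inj₁ P = P
  ... | inj₂ (k , k<n , mkPath {x} {verts = K} w s@(_ , K⊆S) refl , c) with ∃-∖ K uS (≤-trans k<n n≤)
  ... | z , z∈S , z∉K = contradiction (begin
      suc (suc (δ + δ))          ≡⟨ cong suc (+-suc δ δ) ⟨
      suc δ + suc δ              ≤⟨ +-mono-≤ (≤-trans (s≤s (δ≤ (K⊆S (start∈ w)))) (degree<closed uS (start∈ w) c))
                                             (≤-trans (s≤s (δ≤ z∈S)) (degree<closed uS (∈-∖⁺ z∈S z∉K) (closed-∖ K⊆S c))) ⟩
      length K + length (S ∖ K)  ≤⟨ length-∖ s uS ⟩
      length S                   ∎) (<⇒≱ (s≤s ≤2δ+1))
    where open ≤-Reasoning

  degree-++ : ∀ x S T → degree x (S ++ T) ≡ degree x S + degree x T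
  degree-++ x S T = trans (cong length (filter-++ (E? x) S T)) (length-++ (filter (E? x) S))

  degree-all : ∀ {x S} → (∀ {y} → y ∈ S → E x y) → degree x S ≡ length S
  degree-all {x} all = cong length (filter-all (E? x) (All.tabulate all))

  -- A vertex of `X` sees all of `Y`, and a vertex of `Y` sees all of `X` besides its neighbours in
  -- `Y`, so `h` bounds the degrees from below. A join of two nonempty sets is connected, so a
  -- closed path would contain all of its at least `n` vertices.
  join⇒path : ∀ {X Y h n} → Unique (X ++ Y) → (∀ {x y} → x ∈ X → y ∈ Y → E x y) →
    1 ≤ h → 1 ≤ length X → h ≤ length Y → n ≤ length X + length Y → 1 ≤ n → n ≤ suc (h + h) →
    (∀ {w} → w ∈ Y → h ≤ length X + degree w Y) → Path E (X ++ Y) n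
  join⇒path {X} {Y} {h} {n} u X~Y 1≤h 1≤X h≤Y n≤ 1≤n n≤2h+1 Ydeg
    with pick X 1≤X | pick Y (≤-trans 1≤h h≤Y)
  ... | x₀ , x₀∈X | y₀ , y₀∈Y with dirac u deg x₀ (∈-++⁺ˡ x₀∈X) n≤2h+1 1≤n
    where
    deg : ∀ {w} → w ∈ X ++ Y → h ≤ degree w (X ++ Y)
    deg {w} w∈ = subst (h ≤_) (sym (degree-++ w X Y)) (degs (∈-++⁻ X w∈))
      where
      degs : w ∈ X ⊎ w ∈ Y → h ≤ degree w X + degree w Y
      degs (inj₁ w∈X) = ≤-trans (≤-trans h≤Y (≤-reflexive (sym (degree-all (X~Y w∈X))))) (m≤n+m _ _)
      degs (inj₂ w∈Y) = ≤-trans (Ydeg w∈Y) (+-monoˡ-≤ _ (≤-reflexive (sym (degree-all λ x∈X → E-sym (X~Y x∈X w∈Y)))))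
  ... | inj₁ P = P
  ... | inj₂ (k , k<n , mkPath {x} {verts = K} w (_ , K⊆) refl , c) =
    contradiction (≤-trans n≤ (≤-trans (≤-reflexive (sym (length-++ X))) (unique-⊆⇒length≤ u all⊆))) (<⇒≱ k<n)
    where
    X⊆ : ∀ {y} → y ∈ Y → y ∈ K → ∀ {x} → x ∈ X → x ∈ K
    X⊆ y∈Y y∈K x∈X = c y∈K (∈-++⁺ˡ x∈X) (E-sym (X~Y x∈X y∈Y))
    Y⊆ : ∀ {x} → x ∈ X → x ∈ K → ∀ {y} → y ∈ Y → y ∈ K
    Y⊆ x∈X x∈K y∈Y = c x∈K (∈-++⁺ʳ X y∈Y) (X~Y x∈X y∈Y)
    both : x ∈ X ⊎ x ∈ Y → ∀ {z} → z ∈ X ⊎ z ∈ Y → z ∈ K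
    both (inj₁ x∈X) (inj₂ z∈Y) = Y⊆ x∈X (start∈ w) z∈Y
    both (inj₁ x∈X) (inj₁ z∈X) = X⊆ y₀∈Y (Y⊆ x∈X (start∈ w) y₀∈Y) z∈X
    both (inj₂ x∈Y) (inj₁ z∈X) = X⊆ x∈Y (start∈ w) z∈X
    both (inj₂ x∈Y) (inj₂ z∈Y) = Y⊆ x₀∈X (X⊆ x∈Y (start∈ w) x₀∈X) z∈Y
    all⊆ : X ++ Y ⊆ K
    all⊆ z∈ = both (∈-++⁻ X (K⊆ (start∈ w))) (∈-++⁻ X z∈)

-- Path Ramsey numbers

module Growth {V : Set} (_≟_ : DecidableEquality V) (R B : Rel V 0ℓ) (R? : Decidable R)
  (R-sym : Symmetric R) (B-sym : Symmetric B)
  (S : List V) (total : ∀ {x y} → x ∈ S → y ∈ S → x ≢ y → R x y ⊎ B x y) where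

  open CommutativeMonoidSolver (++-commutativeMonoid {A = V}) using (_⊜_; _⊕_) renaming (solve to solve-↭)
  open Difference _≟_

  -- The obstacle to inserting `z` between two consecutive vertices of an `R`-path.
  Avoids : List V → V → Set
  Avoids ps z = Linked (λ p q → B z p ⊎ B z q) ps

  linked : ∀ {P : Rel V 0ℓ} {x y ys z} → P x y → Walk R y ys z → Linked P ys → Linked P (x ∷ ys)
  linked p (stop _) l = p ∷ l
  linked p (_ ∷ _)  l = p ∷ l

  insertOrAvoid : ∀ {z x xs y} → (∀ {p} → p ∈ xs → R z p ⊎ B z p) → Walk R x xs y →
    (∃[ ys ] ∃[ y′ ] (Walk R x ys y′ × ys ↭ z ∷ xs)) ⊎ Avoids xs z
  insertOrAvoid _ (stop x) = inj₂ [-]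
  insertOrAvoid {z} {x} t (_∷_ {y = q} x~q v) with t (here refl) | t (there (start∈ v)) | insertOrAvoid (t ∘ there) v
  ... | inj₁ z~x | inj₁ z~q | _ = inj₁ (_ , _ , R-sym z~x ∷ z~q ∷ v , ↭-swap x z ↭-refl)
  ... | _ | _ | inj₁ (ys , _ , v′ , perm) = inj₁ (x ∷ ys , _ , x~q ∷ v′ , ↭-trans (↭-prep x perm) (↭-swap x z ↭-refl))
  ... | inj₂ b | _      | inj₂ avoid = inj₂ (linked (inj₁ b) v avoid)
  ... | inj₁ _ | inj₂ b | inj₂ avoid = inj₂ (linked (inj₂ b) v avoid)

  -- The final stage of `merge`, when fewer than two vertices of the `R`-path remain; `+ 0` is the
  -- value of its term `⌊ length ps /2⌋ + ⌊ length ps /2⌋` there.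
  joinAt : ∀ p₁ zs ps {a as b c cs d} → Walk B a as b → Walk B c cs d → B a p₁ → B c p₁ →
    Simple S (p₁ ∷ as ++ cs ++ zs ++ ps) →
    ∃[ l ] (suc ((length as + length cs) + 0) ≤ l × Path B S l)
  joinAt p₁ zs ps {as = as} {cs = cs} α β a~p₁ c~p₁ s = _ , ≤-refl ,
    mkPath (glue (reverseWalk B-sym α) a~p₁ (B-sym c~p₁ ∷ β))
      (simple-++ʳ (zs ++ ps) (simple-↭ (↭-trans
        (solve-↭ 5 (λ p₁ as cs zs ps → p₁ ⊕ as ⊕ cs ⊕ zs ⊕ ps ⊜ (zs ⊕ ps) ⊕ as ⊕ p₁ ⊕ cs)
          ↭-refl [ p₁ ] as cs zs ps)
        (++⁺ˡ (zs ++ ps) (++⁺ʳ (p₁ ∷ cs) (↭-sym (↭-reverse as))))) s))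
      (trans (length-++ (reverse as)) (trans (cong (_+ _) (length-reverse as))
        (trans (+-suc _ _) (cong suc (sym (+-identityʳ _))))))

  module _ (p₁ : V) where

    -- A vertex that can neither be attached to the `R`-path at its start `p₁` nor inserted into the
    -- remainder `ps`. Every end of the two `B`-walks in `merge` is of this kind.
    End : List V → V → Set
    End ps z = B z p₁ × Avoids ps z

    shrink : ∀ {p q ps z} → End (p ∷ q ∷ ps) z → End ps z
    shrink (b , _ ∷ l) = b , Linked.tail l

    pick₂ : ∀ {p q ps z} → End (p ∷ q ∷ ps) z → B z p ⊎ B z q
    pick₂ (_ , b ∷ _) = b

    Two : V → V → V → V → Set
    Two a c z r = (B a r × B c r) ⊎ (B a r × B z r) ⊎ (B c r × B z r)

    majority : ∀ {a c z p q} → B a p ⊎ B a q → B c p ⊎ B c q → B z p ⊎ B z q → Two a c z p ⊎ Two a c z q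
    majority (inj₁ a) (inj₁ c) _        = inj₁ (inj₁ (a , c))
    majority (inj₂ a) (inj₂ c) _        = inj₂ (inj₁ (a , c))
    majority (inj₁ a) (inj₂ _) (inj₁ z) = inj₁ (inj₂ (inj₁ (a , z)))
    majority (inj₁ _) (inj₂ c) (inj₂ z) = inj₂ (inj₂ (inj₂ (c , z)))
    majority (inj₂ _) (inj₁ c) (inj₁ z) = inj₁ (inj₂ (inj₂ (c , z)))
    majority (inj₂ a) (inj₁ _) (inj₂ z) = inj₂ (inj₂ (inj₁ (a , z)))

    -- Of three ends, two have a common B-neighbour in any pair of consecutive
    -- vertices of the R-path, so a pair always absorbs one more vertex of zs
    -- into the two B-walks; in the end p₁ joins the two walks.
    merge : ∀ ps zs {a as b c cs d} → Walk B a as b → Walk B c cs d →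
      End ps a → End ps b → End ps c → End ps d → (∀ {z} → z ∈ zs → End ps z) →
      Simple S (p₁ ∷ as ++ cs ++ zs ++ ps) → ⌊ length ps /2⌋ ≤ length zs →
      ∃[ l ] (suc ((length as + length cs) + (⌊ length ps /2⌋ + ⌊ length ps /2⌋)) ≤ l × Path B S l)
    merge (p ∷ q ∷ ps) (z ∷ zs) {a} {as} {b} {c} {cs} {d} α β ea eb ec ed ez s (s≤s le) =
      Sum.[ continue (simple-++ʳ [ q ] (simple-↭ (solve-↭ 7 (λ p₁ as cs zs p q ps →
            p₁ ⊕ as ⊕ cs ⊕ zs ⊕ p ⊕ q ⊕ ps ⊜ q ⊕ p₁ ⊕ as ⊕ cs ⊕ zs ⊕ p ⊕ ps)
            ↭-refl [ p₁ ] as cs (z ∷ zs) [ p ] [ q ] ps) s))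
      , continue (simple-++ʳ [ p ] (simple-↭ (solve-↭ 7 (λ p₁ as cs zs p q ps →
            p₁ ⊕ as ⊕ cs ⊕ zs ⊕ p ⊕ q ⊕ ps ⊜ p ⊕ p₁ ⊕ as ⊕ cs ⊕ zs ⊕ q ⊕ ps)
            ↭-refl [ p₁ ] as cs (z ∷ zs) [ p ] [ q ] ps) s))
      ] (majority (pick₂ ea) (pick₂ ec) (pick₂ (ez (here refl))))
      where
      h : ℕ
      h = ⌊ length ps /2⌋
      Result : ℕ → Set
      Result t = ∃[ l ] (suc (t + (h + h)) ≤ l × Path B S l)
      conclude : ∀ t → t ≡ suc (suc (length as + length cs)) → Result t →
        ∃[ l ] (suc ((length as + length cs) + (suc h + suc h)) ≤ l × Path B S l)
      conclude _ refl (l , le , P) =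
        l , subst (_≤ l) (cong suc (trans (cong suc (sym (+-suc _ (h + h))))
              (trans (sym (+-suc _ (suc (h + h)))) (cong ((length as + length cs) +_) (cong suc (sym (+-suc h h))))))) le , P
      continue : ∀ {r} → Simple S (p₁ ∷ as ++ cs ++ (z ∷ zs) ++ r ∷ ps) → Two a c z r →
        ∃[ l ] (suc ((length as + length cs) + (suc h + suc h)) ≤ l × Path B S l)
      -- If the starts of both walks share `r`, the walks become one and `z` alone is the new second
      -- walk; in the other two cases `r` and `z` prolong one walk. Each time the total length grows
      -- by two.
      continue {r} s (inj₁ (a~r , c~r)) =
        conclude (length (reverse as ++ r ∷ cs) + 1)
          (trans (cong (_+ 1) (trans (length-++ (reverse as)) (cong (_+ _) (length-reverse as))))
                 (trans (+-comm _ 1) (cong suc (+-suc (length as) (length cs)))))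
          (merge ps zs (glue (reverseWalk B-sym α) a~r (B-sym c~r ∷ β)) (stop z)
            (shrink eb) (shrink ed) (shrink (ez (here refl))) (shrink (ez (here refl))) (shrink ∘ ez ∘ there)
            (simple-↭ (↭-trans
              (solve-↭ 7 (λ p₁ as cs z zs r ps →
                 p₁ ⊕ as ⊕ cs ⊕ (z ⊕ zs) ⊕ r ⊕ ps ⊜ p₁ ⊕ (as ⊕ r ⊕ cs) ⊕ z ⊕ zs ⊕ ps)
                 ↭-refl [ p₁ ] as cs [ z ] zs [ r ] ps)
              (↭-prep p₁ (++⁺ʳ _ (++⁺ʳ (r ∷ cs) (↭-sym (↭-reverse as)))))) s) le)
      continue {r} s (inj₂ (inj₁ (a~r , z~r))) =
        conclude (suc (suc (length as)) + length cs) refl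
          (merge ps zs (z~r ∷ B-sym a~r ∷ α) β
            (shrink (ez (here refl))) (shrink eb) (shrink ec) (shrink ed) (shrink ∘ ez ∘ there)
            (simple-↭ (solve-↭ 7 (λ p₁ as cs z zs r ps →
                 p₁ ⊕ as ⊕ cs ⊕ (z ⊕ zs) ⊕ r ⊕ ps ⊜ p₁ ⊕ (z ⊕ r ⊕ as) ⊕ cs ⊕ zs ⊕ ps)
                 ↭-refl [ p₁ ] as cs [ z ] zs [ r ] ps) s) le)
      continue {r} s (inj₂ (inj₂ (c~r , z~r))) =
        conclude (length as + suc (suc (length cs))) (trans (+-suc _ _) (cong suc (+-suc _ _)))
          (merge ps zs α (z~r ∷ B-sym c~r ∷ β)
            (shrink ea) (shrink eb) (shrink (ez (here refl))) (shrink ed) (shrink ∘ ez ∘ there)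
            (simple-↭ (solve-↭ 7 (λ p₁ as cs z zs r ps →
                 p₁ ⊕ as ⊕ cs ⊕ (z ⊕ zs) ⊕ r ⊕ ps ⊜ p₁ ⊕ as ⊕ (z ⊕ r ⊕ cs) ⊕ zs ⊕ ps)
                 ↭-refl [ p₁ ] as cs [ z ] zs [ r ] ps) s) le)
    merge []    zs α β ea _ ec _ _ s _ = joinAt p₁ zs [] α β (proj₁ ea) (proj₁ ec) s
    merge (p ∷ []) zs α β ea _ ec _ _ s _ = joinAt p₁ zs (p ∷ []) α β (proj₁ ea) (proj₁ ec) s

  -- Two vertices of `Z` serve as the initial one-vertex walks, and one more is spent on each pair
  -- of `ps`. Together with `x` this makes 3 + 2⌊l/2⌋ ≥ 2 + l vertices, where l is the length of
  -- `ps`.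
  fromAvoiding : ∀ {x ps} Z → Simple S (x ∷ Z ++ ps) → 2 + ⌊ length ps /2⌋ ≤ length Z →
    (∀ {z} → z ∈ Z → End x ps z) → Path B S (2 + length ps)
  fromAvoiding []       _ ()
  fromAvoiding (_ ∷ []) _ (s≤s ())
  fromAvoiding {x} {ps} (z₁ ∷ z₂ ∷ zs) s (s≤s (s≤s le)) ends =
    let l , l≥ , P = merge x ps zs (stop z₁) (stop z₂) e₁ e₁ e₂ e₂ (ends ∘ there ∘ there) s le
    in truncate (≤-trans (s≤s (s≤s (n≤1+2⌊n/2⌋ (length ps)))) l≥) P
    where
    e₁ : End x ps z₁
    e₁ = ends (here refl)
    e₂ : End x ps z₂
    e₂ = ends (there (here refl))

  -- A vertex off the `R`-path lengthens it at the start or by insertion, or else is an `End`. If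
  -- all vertices off the path are of the last kind, there are enough of them for `fromAvoiding`:
  -- two, and one for each pair among the `k` vertices after the start.
  grow : Unique S → ∀ {k} (P : Path R S (suc k)) → suc k + (2 + ⌊ k /2⌋) ≤ length S →
    Path R S (2 + k) ⊎ Path B S (2 + k)
  grow uS (mkPath {x} {verts = xs} w s l) enough with starts w
  grow uS P@(mkPath {x} w s@(uxs , xs⊆S) refl) enough | ps , refl =
    Sum.map₂ (fromAvoiding Z
      (simple-↭ (↭-prep x (++-comm ps Z)) 
        (Unique.++⁺ uxs (Unique.filter⁺ _ uS) (λ (v∈ , v∈Z) → proj₂ (∈-∖⁻ {S} (x ∷ ps) v∈Z) v∈)
        , λ v∈ → Sum.[ xs⊆S , (λ v∈Z → proj₁ (∈-∖⁻ {S} (x ∷ ps) v∈Z)) ] (∈-++⁻ (x ∷ ps) v∈)))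
      (+-cancelˡ-≤ (length (x ∷ ps)) _ _ (≤-trans enough (length-∖-≥ (x ∷ ps) uS))))
      (collect Z attempt)
    where
    Z : List V
    Z = S ∖ (x ∷ ps)
    attempt : ∀ {z} → z ∈ Z → Path R S (2 + length ps) ⊎ End x ps z
    attempt {z} z∈ with ∈-∖⁻ {S} (x ∷ ps) z∈
    ... | z∈S , z∉xs with t (here refl) | insertOrAvoid t w
      where
      t : ∀ {p} → p ∈ x ∷ ps → R z p ⊎ B z p
      t p∈ = total z∈S (xs⊆S p∈) λ { refl → z∉xs p∈ }
    ... | inj₁ z~x | _ = inj₁ (extendAtStart R-sym P z∈S z∉xs (R-sym z~x))
    ... | inj₂ _   | inj₁ (_ , _ , w′ , perm) =
      inj₁ (mkPath w′ (simple-↭ (↭-sym perm) (simple-∷ z∈S z∉xs s)) (↭-length perm))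
    ... | inj₂ b   | inj₂ avoids = inj₂ (b , Linked.tail avoids)

module Ramsey {V : Set} (_≟_ : DecidableEquality V) (R B : Rel V 0ℓ) (R? : Decidable R) (B? : Decidable B)
  (R-sym : Symmetric R) (B-sym : Symmetric B)
  (S : List V) (total : ∀ {x y} → x ∈ S → y ∈ S → x ≢ y → R x y ⊎ B x y) where

  private
    module GR = Growth _≟_ R B R? R-sym B-sym S total
    module GB = Growth _≟_ B R B? B-sym R-sym S (λ x∈ y∈ x≢y → Sum.swap (total x∈ y∈ x≢y))

  -- The Gerencsér–Gyárfás bound for diagonal path Ramsey numbers, up to an additive constant.
  ramsey : Unique S → ∀ n → 1 ≤ n → n + ⌊ n /2⌋ ≤ length S → Path R S n ⊎ Path B S n
  ramsey uS (suc n) _ n+h≤ = upTo n ≤-refl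
    where
    upTo : ∀ k → k ≤ n → Path R S (suc k) ⊎ Path B S (suc k)
    upTo zero _ with pick S (≤-trans (s≤s z≤n) n+h≤)
    ... | v , v∈S = inj₁ (mkPath (stop v) ([] ∷ [] , λ { (here refl) → v∈S }) refl)
    upTo (suc k) k<n = Sum.[ (λ P → GR.grow uS P enough) , (λ P → Sum.swap (GB.grow uS P enough)) ] (upTo k (<⇒≤ k<n))
      where
      enough : suc k + (2 + ⌊ k /2⌋) ≤ length S
      enough = begin
        suc k + (2 + ⌊ k /2⌋)      ≡⟨ +-suc (suc k) _ ⟩
        suc (suc k) + ⌊ 2 + k /2⌋  ≤⟨ +-mono-≤ (s≤s k<n) (⌊n/2⌋-mono (s≤s k<n)) ⟩
        suc n + ⌊ suc n /2⌋        ≤⟨ n+h≤ ⟩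
        length S                   ∎
        where open ≤-Reasoning

-- A path in one colour or a kipas in the other

⌊n/2⌋+⌊n/2⌋≤n : ∀ n → ⌊ n /2⌋ + ⌊ n /2⌋ ≤ n
⌊n/2⌋+⌊n/2⌋≤n n = ≤-trans (+-monoʳ-≤ ⌊ n /2⌋ (⌊n/2⌋≤⌈n/2⌉ n)) (≤-reflexive (⌊n/2⌋+⌈n/2⌉≡n n))

module TwoColours {V : Set} (_≟_ : DecidableEquality V) (R B : Rel V 0ℓ) (R? : Decidable R) (B? : Decidable B)
  (R-sym : Symmetric R) (B-sym : Symmetric B) (R-irr : ∀ {x} → ¬ R x x) (B-irr : ∀ {x} → ¬ B x x)
  (S : List V) (uS : Unique S) (total : ∀ {x y} → x ∈ S → y ∈ S → x ≢ y → R x y ⊎ B x y) where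

  open Difference _≟_
  private
    module R = Dirac _≟_ R R? R-sym R-irr
    module B = Dirac _≟_ B B? B-sym B-irr

  degree-sum : ∀ {v} → v ∈ S → length S ≤ suc (R.degree v S + B.degree v S)
  degree-sum {v} v∈S = ≤-trans (unique-⊆⇒length≤ uS sub) (s≤s (≤-reflexive (length-++ (filter (R? v) S))))
    where
    sub : S ⊆ v ∷ filter (R? v) S ++ filter (B? v) S
    sub {x} x∈S with v ≟ x
    ... | yes refl = here refl
    ... | no v≢x with total v∈S x∈S v≢x
    ... | inj₁ r = there (∈-++⁺ˡ (∈-filter⁺ (R? v) x∈S r))
    ... | inj₂ b = there (∈-++⁺ʳ _ (∈-filter⁺ (B? v) x∈S b))

  BlueKipas : ℕ → Set
  BlueKipas n = ∃[ v ] Path B (filter (B? v) S) n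

  -- A vertex of blue degree at least n + ⌊n/2⌋ is settled by the path Ramsey bound in its blue
  -- neighbourhood. Otherwise all red degrees are at least ⌊n/2⌋, and Dirac's argument, applied
  -- twice, gives a red path or two red components `K₁`, `K₂` with fewer than `n` vertices each.
  -- Some `v` lies outside both and is blue to both. The two are joined in blue, and each has more
  -- than ⌊n/2⌋ vertices, so the blue path exists among them.
  path⊎kipas : ∀ {n} → 2 ≤ n → n + n ≤ length S → Path R S n ⊎ BlueKipas n
  path⊎kipas {n} 2≤n 2n≤ with collect S alternative
    where
    alternative : ∀ {v} → v ∈ S → (Path R S n ⊎ BlueKipas n) ⊎ ⌊ n /2⌋ ≤ R.degree v S
    alternative {v} v∈S with n + ⌊ n /2⌋ ≤? B.degree v S
    ... | yes le = inj₁ (Sum.map (widen (proj₁ ∘ ∈-filter⁻ (B? v))) (v ,_)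
            (Ramsey.ramsey _≟_ R B R? B? R-sym B-sym (filter (B? v) S)
              (λ x∈ y∈ → total (proj₁ (∈-filter⁻ (B? v) x∈)) (proj₁ (∈-filter⁻ (B? v) y∈)))
              (Unique.filter⁺ (B? v) uS) n (<⇒≤ 2≤n) le))
    ... | no ≰ = inj₂ (+-cancelʳ-≤ (n + h) h (R.degree v S) (begin
        h + (n + h)                          ≡⟨ rearrange h n ⟩
        n + (h + h)                          ≤⟨ +-monoʳ-≤ n (⌊n/2⌋+⌊n/2⌋≤n n) ⟩
        n + n                                ≤⟨ 2n≤ ⟩
        length S                             ≤⟨ degree-sum v∈S ⟩
        suc (R.degree v S + B.degree v S)    ≡⟨ +-suc _ _ ⟨
        R.degree v S + suc (B.degree v S)    ≤⟨ +-monoʳ-≤ (R.degree v S) (≰⇒> ≰) ⟩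
        R.degree v S + (n + h)               ∎))
      where
      open ≤-Reasoning
      h = ⌊ n /2⌋
      rearrange : ∀ h n → h + (n + h) ≡ n + (h + h)
      rearrange = solve-∀
  ... | inj₁ found = found
  ... | inj₂ h≤deg with pick S (≤-trans (≤-trans (<⇒≤ 2≤n) (m≤m+n n n)) 2n≤)
  ... | s₁ , s₁∈S with R.dirac uS h≤deg s₁ s₁∈S (n≤1+2⌊n/2⌋ n) (<⇒≤ 2≤n)
  ... | inj₁ P = inj₁ P
  ... | inj₂ (k₁ , k₁<n , mkPath {x₁} {verts = K₁} w₁ (u₁ , K₁⊆S) refl , c₁)
    with ∃-∖ {S} K₁ uS (≤-trans k₁<n (≤-trans (m≤m+n n n) 2n≤))
  ... | s₂ , s₂∈S , s₂∉K₁ with R.dirac {S ∖ K₁} (Unique.filter⁺ _ uS)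
      (λ x∈ → ≤-trans (h≤deg (proj₁ (∈-∖⁻ {S} K₁ x∈))) (R.degree-∖-closed uS K₁⊆S c₁ x∈))
      s₂ (∈-∖⁺ s₂∈S s₂∉K₁) (n≤1+2⌊n/2⌋ n) (<⇒≤ 2≤n)
  ... | inj₁ P = inj₁ (widen (λ x∈ → proj₁ (∈-∖⁻ {S} K₁ x∈)) P)
  ... | inj₂ (k₂ , k₂<n , mkPath {x₂} {verts = K₂} w₂ (u₂ , K₂⊆) refl , c₂)
    with ∃-∖ {S} (K₁ ++ K₂) uS
      (≤-trans (s≤s (≤-trans (≤-reflexive (length-++ K₁)) (+-monoʳ-≤ (length K₁) (<⇒≤ k₂<n))))
               (≤-trans (+-monoˡ-≤ n k₁<n) 2n≤))
  ... | v , v∈S , v∉ = inj₂ (v , widen sub (B.join⇒path {K₁} {K₂} {⌊ n /2⌋} uK K₁~K₂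
            (⌊n/2⌋-mono 2≤n) (≤-trans (s≤s z≤n) h<K₁) (<⇒≤ h<K₂) n≤ (<⇒≤ 2≤n) (n≤1+2⌊n/2⌋ n)
            (λ _ → ≤-trans (<⇒≤ h<K₁) (m≤m+n _ _))))
    where
    h<K₁ : ⌊ n /2⌋ < length K₁
    h<K₁ = ≤-trans (s≤s (h≤deg (K₁⊆S (start∈ w₁)))) (R.degree<closed uS (start∈ w₁) c₁)
    x₂∈ : x₂ ∈ S ∖ K₁
    x₂∈ = K₂⊆ (start∈ w₂)
    h<K₂ : ⌊ n /2⌋ < length K₂
    h<K₂ = ≤-trans (s≤s (≤-trans (h≤deg (proj₁ (∈-∖⁻ {S} K₁ x₂∈))) (R.degree-∖-closed uS K₁⊆S c₁ x₂∈)))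
                   (R.degree<closed (Unique.filter⁺ _ uS) (start∈ w₂) c₂)
    n≤ : n ≤ length K₁ + length K₂
    n≤ = ≤-trans (n≤1+2⌊n/2⌋ n) (+-mono-≤ h<K₁ (<⇒≤ h<K₂))
    K₁~K₂ : ∀ {x y} → x ∈ K₁ → y ∈ K₂ → B x y
    K₁~K₂ {x} {y} x∈ y∈ = let y∈S , y∉K₁ = ∈-∖⁻ {S} K₁ (K₂⊆ y∈) in
      Sum.[ (λ x~y → contradiction (c₁ x∈ y∈S x~y) y∉K₁) , (λ b → b) ] (total (K₁⊆S x∈) y∈S λ { refl → y∉K₁ x∈ })
    uK : Unique (K₁ ++ K₂)
    uK = Unique.++⁺ u₁ u₂ λ (x∈K₁ , x∈K₂) → proj₂ (∈-∖⁻ {S} K₁ (K₂⊆ x∈K₂)) x∈K₁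
    sub : K₁ ++ K₂ ⊆ filter (B? v) S
    sub {x} x∈ = ∈-filter⁺ (B? v) x∈S (Sum.[ (λ v~x → contradiction (stays (R-sym v~x)) v∉) , (λ b → b) ]
        (total v∈S x∈S λ { refl → v∉ x∈ }))
      where
      x∈S : x ∈ S
      x∈S = Sum.[ K₁⊆S , (λ x∈K₂ → proj₁ (∈-∖⁻ {S} K₁ (K₂⊆ x∈K₂))) ] (∈-++⁻ K₁ x∈)
      stays : R x v → v ∈ K₁ ++ K₂
      stays x~v = Sum.[ (λ x∈K₁ → ∈-++⁺ˡ (c₁ x∈K₁ v∈S x~v))
                      , (λ x∈K₂ → ∈-++⁺ʳ K₁ (c₂ x∈K₂ (∈-∖⁺ v∈S (v∉ ∘ ∈-++⁺ˡ)) x~v)) ] (∈-++⁻ K₁ x∈)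

-- The upper bound

lookup-injective : ∀ {A : Set} {xs : List A} → Unique xs → ∀ {i j} → lookup xs i ≡ lookup xs j → i ≡ j
lookup-injective (_ ∷ _)  {zero}  {zero}  _  = refl
lookup-injective (x∉ ∷ _) {zero}  {suc j} eq = contradiction eq (All.lookup x∉ (∈-lookup j))
lookup-injective (x∉ ∷ _) {suc i} {zero}  eq = contradiction (sym eq) (All.lookup x∉ (∈-lookup i))
lookup-injective (_ ∷ u)  {suc i} {suc j} eq = cong suc (lookup-injective u eq)

walk-lookup : ∀ {V : Set} {E : Rel V 0ℓ} {x xs y} → Walk E x xs y →
  ∀ i j → suc (toℕ i) ≡ toℕ j → E (lookup xs i) (lookup xs j)
walk-lookup (stop _) zero zero ()
walk-lookup (e ∷ stop _)  zero (suc zero) _ = e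
walk-lookup (e ∷ (_ ∷ _)) zero (suc zero) _ = e
walk-lookup (_ ∷ w) (suc i) (suc j) eq = walk-lookup w i j (suc-injective eq)

record Distinct (p q r : Fin 3) : Set where
  constructor distinct
  field
    p≢q : p ≢ q
    p≢r : p ≢ r
    q≢r : q ≢ r

swap₁₂ : ∀ {p q r} → Distinct p q r → Distinct q p r
swap₁₂ (distinct a b c) = distinct (≢-sym a) c b

swap₂₃ : ∀ {p q r} → Distinct p q r → Distinct p r q
swap₂₃ (distinct a b c) = distinct b a (≢-sym c)

third : (p q r c : Fin 3) → p ≢ q → p ≢ r → q ≢ r → c ≢ p → c ≢ q → c ≡ r
third = from-yes (all? {n = 3} λ p → all? λ q → all? λ r → all? λ c →
  ¬? (p ≟ᶠ q) →-dec ¬? (p ≟ᶠ r) →-dec ¬? (q ≟ᶠ r) →-dec ¬? (c ≟ᶠ p) →-dec ¬? (c ≟ᶠ q) →-dec (c ≟ᶠ r))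

module ColourGraphs {m : ℕ} (χ : Coloring 3 m) where

  E : Fin 3 → Rel (Fin m) 0ℓ
  E c x y = x ≢ y × color χ x y ≡ c

  E? : ∀ c → Decidable (E c)
  E? c x y = ¬? (x ≟ᶠ y) ×-dec (color χ x y ≟ᶠ c)

  E-sym : ∀ c → Symmetric (E c)
  E-sym c (x≢y , eq) = ≢-sym x≢y , trans (color-sym χ _ _) eq

  E-irr : ∀ c {x} → ¬ E c x x
  E-irr c (x≢x , _) = x≢x refl

  module Deg (c : Fin 3) = Dirac _≟ᶠ_ (E c) (E? c) (E-sym c) (E-irr c)

  deg : Fin 3 → Fin m → List (Fin m) → ℕ
  deg = Deg.degree

  path⇒kipas : ∀ {c v S n} → Path (E c) S n → (∀ {x} → x ∈ S → E c v x) → ∃ (Monochromatic χ (kipas n))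
  path⇒kipas {c} {v} (mkPath {verts = xs} w (u , xs⊆S) refl) spoke =
    mk↣ {to = φ} φ-injective , c , mono
    where
    φ : Fin (suc (length xs)) → Fin m
    φ zero    = v
    φ (suc i) = lookup xs i
    ray : ∀ i → E c v (lookup xs i)
    ray i = spoke (xs⊆S (∈-lookup i))
    φ-injective : ∀ {i j} → φ i ≡ φ j → i ≡ j
    φ-injective {zero}  {zero}  _  = refl
    φ-injective {zero}  {suc j} eq = contradiction eq (proj₁ (ray j))
    φ-injective {suc i} {zero}  eq = contradiction (sym eq) (proj₁ (ray i))
    φ-injective {suc i} {suc j} eq = cong suc (lookup-injective u eq)
    mono : ∀ {i j} → ConeAdj (path (length xs)) i j → color χ (φ i) (φ j) ≡ c
    mono (center-base i)       = proj₂ (ray i)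
    mono (base-center i)       = proj₂ (E-sym c (ray i))
    mono (base-base (inj₁ eq)) = proj₂ (walk-lookup w _ _ eq)
    mono (base-base (inj₂ eq)) = proj₂ (E-sym c (walk-lookup w _ _ eq))

  -- A vertex may miss several colours; `μ` fixes one of them.
  module Classes (μ : Fin m → Fin 3) (missing : ∀ {x y} → x ≢ y → color χ x y ≢ μ x) where

    cls : Fin 3 → List (Fin m)
    cls c = filter (λ v → μ v ≟ᶠ c) (allFin m)

    cls-unique : ∀ c → Unique (cls c)
    cls-unique c = Unique.filter⁺ _ (Unique.allFin⁺ m)

    ∈-cls⁻ : ∀ {c v} → v ∈ cls c → μ v ≡ c
    ∈-cls⁻ v∈ = proj₂ (∈-filter⁻ _ {xs = allFin m} v∈)

    ∈-cls⁺ : ∀ v → v ∈ cls (μ v)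
    ∈-cls⁺ v = ∈-filter⁺ _ (∈-allFin v) refl

    size : Fin 3 → ℕ
    size c = length (cls c)

    module Triple {p q r : Fin 3} (d : Distinct p q r) where

      open Distinct d

      -- An edge between the classes avoids the missing colours `p` and `q` of its two ends, so only
      -- `r` is left. Inside class `p` only `p` is excluded.
      between : ∀ {x y} → x ∈ cls p → y ∈ cls q → E r x y
      between {x} {y} x∈ y∈ with ∈-cls⁻ x∈ | ∈-cls⁻ y∈
      ... | refl | refl = x≢y , third _ _ r (color χ x y) p≢q p≢r q≢r (missing x≢y)
              (λ eq → missing (≢-sym x≢y) (trans (color-sym χ y x) eq))
        where
        x≢y : x ≢ y
        x≢y refl = p≢q refl

      within : ∀ {x y} → x ∈ cls p → y ∈ cls p → x ≢ y → E q x y ⊎ E r x y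
      within {x} {y} x∈ _ x≢y with ∈-cls⁻ x∈ | color χ x y ≟ᶠ q
      ... | _    | yes eq = inj₁ (x≢y , eq)
      ... | refl | no ≢q  = inj₂ (x≢y , third _ q r (color χ x y) p≢q p≢r q≢r (missing x≢y) ≢q)

      module Inside = TwoColours _≟ᶠ_ (E r) (E q) (E? r) (E? q) (E-sym r) (E-sym q) (E-irr r) (E-irr q)

      degree-sum : ∀ {v} → v ∈ cls p → size p ≤ suc (deg r v (cls p) + deg q v (cls p))
      degree-sum = Inside.degree-sum (cls p) (cls-unique p) (λ x∈ y∈ x≢y → Sum.swap (within x∈ y∈ x≢y))

      disjoint-from : ∀ {X} c d → c ≢ d → X ⊆ cls c → Unique X → Unique (X ++ cls d)
      disjoint-from c d c≢d X⊆ uX = Unique.++⁺ uX (cls-unique d)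
        λ (x∈X , x∈d) → c≢d (trans (sym (∈-cls⁻ (X⊆ x∈X))) (∈-cls⁻ x∈d))

      total : m ≤ size p + size q + size r
      total = begin
        m                                      ≡⟨ length-tabulate {n = m} (λ i → i) ⟨
        length (allFin m)                      ≤⟨ unique-⊆⇒length≤ (Unique.allFin⁺ m) (λ {v} _ → place v (μ v) refl) ⟩
        length ((cls p ++ cls q) ++ cls r)     ≡⟨ length-++ (cls p ++ cls q) ⟩
        length (cls p ++ cls q) + size r       ≡⟨ cong (_+ size r) (length-++ (cls p)) ⟩
        size p + size q + size r               ∎
        where
        open ≤-Reasoning
        place : ∀ v c → μ v ≡ c → v ∈ (cls p ++ cls q) ++ cls r
        place v c refl with c ≟ᶠ p | c ≟ᶠ q
        ... | yes eq | _      = ∈-++⁺ˡ (∈-++⁺ˡ (subst (λ c → v ∈ cls c) eq (∈-cls⁺ v)))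
        ... | no _   | yes eq = ∈-++⁺ˡ (∈-++⁺ʳ (cls p) (subst (λ c → v ∈ cls c) eq (∈-cls⁺ v)))
        ... | no ≢p  | no ≢q  = ∈-++⁺ʳ (cls p ++ cls q)
          (subst (λ c → v ∈ cls c) (third p q r c p≢q p≢r q≢r ≢p ≢q) (∈-cls⁺ v))

    module KipasFree (n : ℕ) (2≤n : 2 ≤ n) (kipasFree : ¬ ∃ (Monochromatic χ (kipas n))) where

      h h′ : ℕ
      h  = ⌊ n /2⌋
      h′ = ⌈ n /2⌉

      h+h≤n : h + h ≤ n
      h+h≤n = ⌊n/2⌋+⌊n/2⌋≤n n

      h+h′≡n : h + h′ ≡ n
      h+h′≡n = ⌊n/2⌋+⌈n/2⌉≡n n

      h≤h′ : h ≤ h′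
      h≤h′ = ⌊n/2⌋≤⌈n/2⌉ n

      h′≤1+h : h′ ≤ suc h
      h′≤1+h = ⌊n/2⌋-mono (n≤1+n (suc n))

      1≤h : 1 ≤ h
      1≤h = ⌊n/2⌋-mono 2≤n

      1≤n : 1 ≤ n
      1≤n = <⇒≤ 2≤n

      module _ {p q r : Fin 3} (d : Distinct p q r) where

        open Distinct d
        open Triple d

        -- The `r`-neighbours of `v` inside class `p` and the whole class `q` form a join in colour
        -- `r`, all of it adjacent to `v` in colour `r`. A path on `n` vertices in this join, with
        -- centre `v`, is a kipas.
        no-join : ∀ {v} → v ∈ cls p → let x = deg r v (cls p) in
          1 ≤ x → h ≤ size q → n ≤ x + size q → (∀ {w} → w ∈ cls q → h ≤ x + deg r w (cls q)) → ⊥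
        no-join {v} v∈ 1≤x h≤q n≤ q-deg =
          kipasFree (path⇒kipas (Deg.join⇒path r {X} {cls q} {h}
            (disjoint-from p q p≢q X⊆ (Unique.filter⁺ _ (cls-unique p)))
            (λ x∈ y∈ → between (X⊆ x∈) y∈) 1≤h 1≤x h≤q n≤ 1≤n (n≤1+2⌊n/2⌋ n) q-deg) spoke)
          where
          X : List (Fin m)
          X = filter (E? r v) (cls p)
          X⊆ : X ⊆ cls p
          X⊆ x∈ = proj₁ (∈-filter⁻ (E? r v) {xs = cls p} x∈)
          spoke : ∀ {x} → x ∈ X ++ cls q → E r v x
          spoke x∈ = Sum.[ (λ x∈X → proj₂ (∈-filter⁻ (E? r v) {xs = cls p} x∈X)) , between v∈ ] (∈-++⁻ X x∈)

        -- With `h` such neighbours the join would have at least `h + h′`, that is `n`, vertices,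
        -- and they alone would give each vertex of class `q` the required degree.
        sparse : ∀ {v} → v ∈ cls p → h′ ≤ size q → deg r v (cls p) < h
        sparse v∈ h′≤q = ≰⇒> λ h≤x → no-join v∈ (≤-trans 1≤h h≤x) (≤-trans h≤h′ h′≤q)
          (≤-trans (≤-reflexive (sym h+h′≡n)) (+-mono-≤ h≤x h′≤q)) (λ _ → ≤-trans h≤x (m≤m+n _ _))

        size≤ : ∀ {v} → v ∈ cls p → deg q v (cls p) < h → size p ≤ deg r v (cls p) + h
        size≤ {v} v∈ y<h = begin
          size p                                         ≤⟨ degree-sum v∈ ⟩
          suc (deg r v (cls p) + deg q v (cls p))        ≡⟨ +-suc _ _ ⟨
          deg r v (cls p) + suc (deg q v (cls p))        ≤⟨ +-monoʳ-≤ (deg r v (cls p)) y<h ⟩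
          deg r v (cls p) + h                            ∎
          where open ≤-Reasoning

        -- Each vertex of the colour-q neighbourhood S of v has at most h non-neighbours
        -- in colour q within S (itself included), so Dirac's condition holds once S has n vertices.
        no-dense : ∀ {v} → v ∈ cls p → (∀ {w} → w ∈ cls p → deg r w (cls p) < h) → size r ≤ h →
          deg q v (cls p) + size r < n
        no-dense {v} v∈ r-sparse c≤h = ≰⇒> λ n≤ → kipasFree (path⇒kipas (spanning n≤) spoke)
          where
          Y S : List (Fin m)
          Y = filter (E? q v) (cls p)
          S = Y ++ cls r
          Y⊆ : Y ⊆ cls p
          Y⊆ x∈ = proj₁ (∈-filter⁻ (E? q v) {xs = cls p} x∈)
          uY : Unique Y
          uY = Unique.filter⁺ _ (cls-unique p)
          cross : ∀ {x y} → x ∈ cls p → y ∈ cls r → E q x y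
          cross = Triple.between (swap₂₃ d)
          spoke : ∀ {x} → x ∈ S → E q v x
          spoke x∈ = Sum.[ (λ x∈Y → proj₂ (∈-filter⁻ (E? q v) {xs = cls p} x∈Y)) , cross v∈ ] (∈-++⁻ Y x∈)
          |S| : length S ≡ length Y + size r
          |S| = length-++ Y
          degrees : ∀ {x} → x ∈ Y ⊎ x ∈ cls r → length S ≤ h + deg q x S
          degrees {x} (inj₁ x∈Y) = begin
            length S                                      ≡⟨ |S| ⟩
            length Y + size r                             ≤⟨ +-monoˡ-≤ (size r) (begin
              length Y                                      ≤⟨ Inside.degree-sum Y uY
                                                                 (λ a b x≢y → Sum.swap (within (Y⊆ a) (Y⊆ b) x≢y)) x∈Y ⟩
              suc (deg r x Y) + deg q x Y                   ≤⟨ +-monoˡ-≤ _ (≤-trans (s≤s (Deg.degree-⊆ r uY (λ y∈ _ → Y⊆ y∈)))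
                                                                                  (r-sparse (Y⊆ x∈Y))) ⟩
              h + deg q x Y                                 ∎) ⟩
            h + deg q x Y + size r                        ≡⟨ +-assoc h _ _ ⟩
            h + (deg q x Y + size r)                      ≡⟨ cong (λ k → h + (deg q x Y + k)) (Deg.degree-all q (cross (Y⊆ x∈Y))) ⟨
            h + (deg q x Y + deg q x (cls r))             ≡⟨ cong (h +_) (Deg.degree-++ q x Y (cls r)) ⟨
            h + deg q x S                                 ∎
            where open ≤-Reasoning
          degrees {x} (inj₂ x∈r) = begin
            length S                                      ≡⟨ |S| ⟩
            length Y + size r                             ≤⟨ +-monoʳ-≤ (length Y) c≤h ⟩
            length Y + h                                  ≡⟨ +-comm (length Y) h ⟩
            h + length Y                                  ≡⟨ cong (h +_) (Deg.degree-all q (λ y∈Y → E-sym q (cross (Y⊆ y∈Y) x∈r))) ⟨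
            h + deg q x Y                                 ≤⟨ +-monoʳ-≤ h (m≤m+n _ _) ⟩
            h + (deg q x Y + deg q x (cls r))             ≡⟨ cong (h +_) (Deg.degree-++ q x Y (cls r)) ⟨
            h + deg q x S                                 ∎
            where open ≤-Reasoning
          spanning : n ≤ length Y + size r → Path (E q) S n
          -- The minimum degree is at least `length S ∸ h`, which is at least half of `length S`
          -- because `h + h ≤ n ≤ length S`.
          spanning n≤ = Deg.dense⇒path q {δ = length S ∸ h} (disjoint-from p r p≢r Y⊆ uY)
            (λ x∈ → m≤n+o⇒m∸n≤o (length S) h (degrees (∈-++⁻ Y x∈))) 1≤n n≤S (begin
              length S                              ≡⟨ m+[n∸m]≡n h≤S ⟨
              h + (length S ∸ h)                    ≤⟨ +-monoˡ-≤ _ h≤δ ⟩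
              (length S ∸ h) + (length S ∸ h)       ≤⟨ n≤1+n _ ⟩
              suc ((length S ∸ h) + (length S ∸ h)) ∎)
            where
            open ≤-Reasoning
            n≤S : n ≤ length S
            n≤S = ≤-trans n≤ (≤-reflexive (sym |S|))
            h≤S : h ≤ length S
            h≤S = ≤-trans (≤-trans (m≤m+n h h) h+h≤n) n≤S
            h≤δ : h ≤ length S ∸ h
            h≤δ = ≤-trans (≤-reflexive (sym (m+n∸n≡m h h))) (∸-monoˡ-≤ h (≤-trans h+h≤n n≤S))

        size+size≤ : ∀ {v} → v ∈ cls p → deg q v (cls p) + size r < n → size p + size r ≤ deg r v (cls p) + n
        size+size≤ {v} v∈ < = begin
          size p + size r                                        ≤⟨ +-monoˡ-≤ (size r) (degree-sum v∈) ⟩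
          suc (deg r v (cls p) + deg q v (cls p)) + size r       ≡⟨ cong suc (+-assoc (deg r v (cls p)) _ _) ⟩
          suc (deg r v (cls p) + (deg q v (cls p) + size r))     ≡⟨ +-suc _ _ ⟨
          deg r v (cls p) + suc (deg q v (cls p) + size r)       ≤⟨ +-monoʳ-≤ (deg r v (cls p)) < ⟩
          deg r v (cls p) + n                                    ∎
          where open ≤-Reasoning

      module Sorted {p q r : Fin 3} (d : Distinct p q r) (q≤p : size q ≤ size p) (r≤q : size r ≤ size q)
        (large : n + n + h ≤ m) where

        sum : n + n + h ≤ size p + size q + size r
        sum = ≤-trans large (Triple.total d)

        module Bounds = ThreeSizes (size p) (size q) (size r) h+h≤n sum

        1≤p : 1 ≤ size p
        1≤p = ≰⇒> λ p≤0 → let q≤0 = ≤-trans q≤p p≤0 in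
          contradiction (≤-trans (≤-trans 1≤h (m≤n+m h (n + n)))
            (≤-trans sum (+-mono-≤ (+-mono-≤ p≤0 q≤0) (≤-trans r≤q q≤0)))) λ ()

        -- By `sparse`, colour `q` is rare inside class `p`, colour `p` inside class `q`, and both
        -- of them inside class `r`, so that `size r < h + h`. The total then forces `r`-degrees
        -- inside the classes `p` and `q` that suffice for `no-join`.
        all-large : h′ ≤ size r → ⊥
        all-large h′≤r with pick (cls p) 1≤p | pick (cls r) (≤-trans 1≤h (≤-trans h≤h′ h′≤r))
        ... | v , v∈ | u , u∈ = no-join d v∈ (Bounds.large⇒degree≥1 1≤h q≤p (≤-trans r≤q q≤p) p≤)
                (≤-trans h≤h′ h′≤q) (Bounds.n≤x+b p≤ r<)
                (λ w∈ → Bounds.h≤x+d p≤ (size≤ (swap₁₂ d) w∈ (sparse (swap₂₃ (swap₁₂ d)) w∈ h′≤r)) r<)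
          where
          h′≤q : h′ ≤ size q
          h′≤q = ≤-trans h′≤r r≤q
          h′≤p : h′ ≤ size p
          h′≤p = ≤-trans h′≤q q≤p
          p≤ : size p ≤ deg r v (cls p) + h
          p≤ = size≤ d v∈ (sparse (swap₂₃ d) v∈ h′≤r)
          d′ : Distinct r p q
          d′ = swap₁₂ (swap₂₃ d)
          r< : size r < h + h
          r< = ≤-trans (s≤s (size≤ d′ u∈ (sparse (swap₂₃ d′) u∈ h′≤q))) (+-monoˡ-≤ h (sparse d′ u∈ h′≤p))

        -- Class `r` is too small to make colour `q` rare inside class `p` by `sparse`. But `r` is
        -- rare there because class `q` is large, so `no-dense` bounds the `q`-degree plus `size r`.
        -- The same holds with `p` and `q` exchanged, and `no-join` applies again.
        two-large : h′ ≤ size q → size r ≤ h → ⊥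
        two-large h′≤q r≤h with pick (cls p) 1≤p
        ... | v , v∈ = no-join d v∈ (Bounds.large⇒degree≥1′ 1≤h q≤p p+r≤) (≤-trans h≤h′ h′≤q) (Bounds.n≤x+b′ p+r≤)
                (λ w∈ → Bounds.h≤x+d′ p+r≤ (size+size≤ (swap₁₂ d) w∈
                   (no-dense (swap₁₂ d) w∈ (λ z∈ → sparse (swap₁₂ d) z∈ (≤-trans h′≤q q≤p)) r≤h)))
          where
          p+r≤ : size p + size r ≤ deg r v (cls p) + n
          p+r≤ = size+size≤ d v∈ (no-dense d v∈ (λ z∈ → sparse d z∈ h′≤q) r≤h)

        -- Outer vertices serve as centres: `w` is joined to class `p` in colour `r`, and a vertex
        -- `u` of class `r` in colour `q`, so a monochromatic path inside class `p` in either colour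
        -- is enough. If class `r` is empty, a centre for colour `q` has to be found inside class
        -- `p`.
        one-large : 1 ≤ size q → size q ≤ h → ⊥
        one-large 1≤q q≤h with pick (cls q) 1≤q | cls r in eq
        ... | w , w∈ | u ∷ _ = Sum.[
                  (λ P → kipasFree (path⇒kipas P λ x∈ → E-sym q (Triple.between (swap₂₃ d) x∈ u∈)))
                , (λ P → kipasFree (path⇒kipas P λ x∈ → E-sym r (Triple.between d x∈ w∈))) ]
                (Ramsey.ramsey _≟ᶠ_ (E q) (E r) (E? q) (E? r) (E-sym q) (E-sym r) (cls p) (Triple.within d)
                  (cls-unique p) n 1≤n (Bounds.n+h≤a q≤h (≤-trans r≤q q≤h)))
          where
          u∈ : u ∈ cls r
          u∈ = subst (u ∈_) (sym eq) (here refl)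
        ... | w , w∈ | [] = Sum.[
                  (λ P → kipasFree (path⇒kipas P λ x∈ → E-sym r (Triple.between d x∈ w∈)))
                , (λ (v , P) → kipasFree (path⇒kipas P λ x∈ → proj₂ (∈-filter⁻ (E? q v) {xs = cls p} x∈))) ]
                (Triple.Inside.path⊎kipas d (cls p) (cls-unique p) (λ x∈ y∈ x≢y → Sum.swap (Triple.within d x∈ y∈ x≢y))
                  2≤n (Bounds.n+n≤a q≤h (cong length eq)))

        absurd : Exact χ → ⊥
        absurd exact with h′ ≤? size r | h′ ≤? size q
        ... | yes h′≤r | _        = all-large h′≤r
        ... | no h′≰r  | yes h′≤q = two-large h′≤q (s≤s⁻¹ (≤-trans (≰⇒> h′≰r) h′≤1+h))
        ... | no h′≰r  | no h′≰q  = one-large 1≤q (s≤s⁻¹ (≤-trans (≰⇒> h′≰q) h′≤1+h))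
          where
          empty : ∀ c → size c ≤ 0 → ∀ v → μ v ≢ c
          empty c c≤0 v refl with cls (μ v) | ∈-cls⁺ v | c≤0
          ... | [] | () | _
          -- If the classes `q` and `r` were empty, every vertex would miss colour `p`, contrary to
          -- exactness.
          1≤q : 1 ≤ size q
          1≤q = ≰⇒> λ q≤0 → let i , j , i≢j , eq = exact p in
            missing i≢j (trans eq (sym (third q r p (μ i) (Distinct.q≢r d) (≢-sym (Distinct.p≢q d)) (≢-sym (Distinct.p≢r d))
              (empty q q≤0 i) (empty r (≤-trans r≤q q≤0) i))))

-- Deciding Gallai–Ramsey bounds

module _ {a b : ℕ} {P : (Fin a → Fin b) → Set}
         (P-ext : ∀ {f g} → f ≗ g → P f → P g) (P? : ∀ f → Dec (P f)) where

  -- Functions between finite sets are enumerated by their codes. Decoding returns a function only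
  -- up to pointwise equality, hence `P-ext`.
  ∃-fun? : Dec (∃ P)
  ∃-fun? = map′ (λ (k , p) → finToFun k , p)
                (λ (f , p) → funToFin f , P-ext (sym ∘ finToFun-funToFin f) p)
                (any? (P? ∘ finToFun))

DecAdj : Graph → Set
DecAdj G = Decidable (Adj G)

edgeless-adj? : ∀ n → DecAdj (edgeless n)
edgeless-adj? n _ _ = no λ ()

path-adj? : ∀ n → DecAdj (path n)
path-adj? n i j = (suc (toℕ i) ≟ toℕ j) ⊎-dec (suc (toℕ j) ≟ toℕ i)

cone-adj? : ∀ {G} → DecAdj G → DecAdj (cone G)
cone-adj? adj? zero    zero    = no λ ()
cone-adj? adj? zero    (suc v) = yes (center-base v)
cone-adj? adj? (suc u) zero    = yes (base-center u)
cone-adj? adj? (suc u) (suc v) = map′ base-base (λ { (base-base e) → e }) (adj? u v)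

module _ {k m : ℕ} (χ : Coloring k m) {G : Graph} (adj? : DecAdj G) where

  private
    n = order G
    InjectiveMap : (Fin n → Fin m) → Set
    InjectiveMap f = ∀ i j → f i ≡ f j → i ≡ j

    injective? : ∀ f → Dec (InjectiveMap f)
    injective? f = all? λ i → all? λ j → (f i ≟ᶠ f j) →-dec (i ≟ᶠ j)

    injective-ext : ∀ {f g} → f ≗ g → InjectiveMap f → InjectiveMap g
    injective-ext f≗g inj i j eq = inj i j (trans (f≗g i) (trans eq (sym (f≗g j))))

    colour-ext : ∀ {f g : Fin n → Fin m} → f ≗ g → ∀ u v → color χ (f u) (f v) ≡ color χ (g u) (g v)
    colour-ext f≗g u v = cong₂ (color χ) (f≗g u) (f≗g v)

    toCopy : ∀ {f} → InjectiveMap f → Copy G m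
    toCopy {f} inj = mk↣ {to = f} (λ {i} {j} → inj i j)

    fromCopy : (φ : Copy G m) → InjectiveMap (Injection.to φ)
    fromCopy φ _ _ = Injection.injective φ

  ∃-monochromatic? : Dec (∃ (Monochromatic χ G))
  ∃-monochromatic? = map′ (λ (f , inj , c , mono) → toCopy inj , c , λ {u} {v} → mono u v)
      (λ (φ , c , mono) → Injection.to φ , fromCopy φ , c , λ u v → mono)
      (∃-fun? (λ f≗g (inj , c , mono) → injective-ext f≗g inj , c , λ u v e → trans (sym (colour-ext f≗g u v)) (mono u v e))
        (λ f → injective? f ×-dec any? λ c → all? λ u → all? λ v → adj? u v →-dec (color χ (f u) (f v) ≟ᶠ c)))

  ∃-rainbow? : Dec (∃ (Rainbow χ G))
  ∃-rainbow? = map′ (λ (f , inj , rb) → toCopy inj , λ {u} {v} {x} {y} → rb u v x y)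
      (λ (φ , rb) → Injection.to φ , fromCopy φ , λ u v x y → rb)
      (∃-fun? (λ f≗g (inj , rb) → injective-ext f≗g inj , λ u v x y e e′ eq → 
          rb u v x y e e′ (trans (colour-ext f≗g u v) (trans eq (sym (colour-ext f≗g x y)))))
        (λ f → injective? f ×-dec all? λ u → all? λ v → all? λ x → all? λ y → adj? u v →-dec adj? x y →-dec
          (color χ (f u) (f v) ≟ᶠ color χ (f x) (f y)) →-dec
          (((u ≟ᶠ x) ×-dec (v ≟ᶠ y)) ⊎-dec ((u ≟ᶠ y) ×-dec (v ≟ᶠ x)))))

BoundAt : ℕ → Graph → Graph → ℕ → Set
BoundAt k G H m = (χ : Coloring k m) → Exact χ → ∃ (Rainbow χ G) ⊎ ∃ (Monochromatic χ H)

module _ (k m : ℕ) {G H : Graph} (G-adj? : DecAdj G) (H-adj? : DecAdj H) where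

  private
    -- The colour matrices, enumerated through their rows.
    Code : Set
    Code = Fin ((k ^ m) ^ m)

    matrix : Code → Fin m → Fin m → Fin k
    matrix e i = finToFun (finToFun {k ^ m} {m} e i)

    Coloured : (e : Code) → (∀ i j → matrix e i j ≡ matrix e j i) → Coloring k m
    Coloured e s = record { color = matrix e ; color-sym = s }

    -- A code may give a matrix that is not symmetric; the quantification over `s` makes the claim
    -- vacuous for it.
    BoundFor : Code → Set
    BoundFor e = ∀ s → Exact (Coloured e s) → ∃ (Rainbow (Coloured e s) G) ⊎ ∃ (Monochromatic (Coloured e s) H)

    boundFor? : ∀ e → Dec (BoundFor e)
    boundFor? e with all? (λ i → all? λ j → matrix e i j ≟ᶠ matrix e j i)
    ... | no ¬s = yes λ s → contradiction s ¬s
    -- None of the notions looks at the proof of symmetry, so the answer for `s` holds for every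
    -- `s′`.
    ... | yes s = map′ (λ b s′ → b) (λ b → b s)
            ((all? λ c → any? λ i → any? λ j → ¬? (i ≟ᶠ j) ×-dec (matrix e i j ≟ᶠ c)) →-dec
             (∃-rainbow? (Coloured e s) {G} G-adj? ⊎-dec ∃-monochromatic? (Coloured e s) {H} H-adj?))

  boundAt? : Dec (BoundAt k G H m)
  boundAt? = map′ to (λ b e s → b (Coloured e s)) (all? boundFor?)
    where
    to : (∀ e → BoundFor e) → BoundAt k G H m
    to b χ exact = Sum.map
        (λ (φ , rb) → φ , λ e e′ eq → rb e e′ (trans (entry _ _) (trans eq (sym (entry _ _)))))
        (λ (φ , c , mono) → φ , c , λ e → trans (sym (entry _ _)) (mono e))
        (b code (λ i j → trans (entry i j) (trans (color-sym χ i j) (sym (entry j i))))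
          (λ c → let i , j , i≢j , eq = exact c in i , j , i≢j , trans (entry i j) eq))
      where
      code : Code
      code = funToFin (λ i → funToFin (color χ i))
      entry : ∀ i j → matrix code i j ≡ color χ i j
      entry i j = trans (cong (λ r → finToFun r j) (finToFun-funToFin (λ i → funToFin (color χ i)) i))
                        (finToFun-funToFin (color χ i) j)

-- Assembling the upper bound

sort₃ : (f : Fin 3 → ℕ) → ∃[ p ] ∃[ q ] ∃[ r ] (Distinct p q r × f q ≤ f p × f r ≤ f q)
sort₃ f with ≤-total (f zero) (f (suc zero)) | ≤-total (f (suc zero)) (f (suc (suc zero))) | ≤-total (f zero) (f (suc (suc zero)))
... | inj₁ 0≤1 | inj₁ 1≤2 | _        = _ , _ , _ , distinct (λ ()) (λ ()) (λ ()) , 1≤2 , 0≤1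
... | inj₁ 0≤1 | inj₂ 2≤1 | inj₁ 0≤2 = _ , _ , _ , distinct (λ ()) (λ ()) (λ ()) , 2≤1 , 0≤2
... | inj₁ 0≤1 | inj₂ 2≤1 | inj₂ 2≤0 = _ , _ , _ , distinct (λ ()) (λ ()) (λ ()) , 0≤1 , 2≤0
... | inj₂ 1≤0 | inj₁ 1≤2 | inj₁ 0≤2 = _ , _ , _ , distinct (λ ()) (λ ()) (λ ()) , 0≤2 , 1≤0
... | inj₂ 1≤0 | inj₁ 1≤2 | inj₂ 2≤0 = _ , _ , _ , distinct (λ ()) (λ ()) (λ ()) , 2≤0 , 1≤2
... | inj₂ 1≤0 | inj₂ 2≤1 | _        = _ , _ , _ , distinct (λ ()) (λ ()) (λ ()) , 1≤0 , 2≤1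

module _ {m : ℕ} (χ : Coloring 3 m) where

  open ColourGraphs χ

  -- The leaf `suc c` is joined to `v` in colour `c`, so the colour of an edge tells its leaf. This
  -- gives both the injectivity and the rainbow property.
  allColours⇒rainbow : ∀ v → (∀ c → ∃[ x ] E c v x) → ∃ (Rainbow χ (star 3))
  allColours⇒rainbow v leaf = mk↣ {to = φ} φ-injective , rainbow
    where
    φ : Fin 4 → Fin m
    φ zero    = v
    φ (suc c) = proj₁ (leaf c)
    tip : ∀ c → color χ v (φ (suc c)) ≡ c
    tip c = proj₂ (proj₂ (leaf c))
    φ-injective : ∀ {i j} → φ i ≡ φ j → i ≡ j
    φ-injective {zero}  {zero}  _  = refl
    φ-injective {zero}  {suc d} eq = contradiction eq (proj₁ (proj₂ (leaf d)))
    φ-injective {suc c} {zero}  eq = contradiction (sym eq) (proj₁ (proj₂ (leaf c)))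
    φ-injective {suc c} {suc d} eq = cong suc (trans (sym (tip c)) (trans (cong (color χ v) eq) (tip d)))
    tip′ : ∀ c → color χ (φ (suc c)) v ≡ c
    tip′ c = trans (color-sym χ _ v) (tip c)
    rainbow : ∀ {u w x y} → ConeAdj (edgeless 3) u w → ConeAdj (edgeless 3) x y →
      color χ (φ u) (φ w) ≡ color χ (φ x) (φ y) → (u ≡ x × w ≡ y) ⊎ (u ≡ y × w ≡ x)
    rainbow (center-base c) (center-base d) eq = inj₁ (refl , cong suc (trans (sym (tip c)) (trans eq (tip d))))
    rainbow (center-base c) (base-center d) eq = inj₂ (refl , cong suc (trans (sym (tip c)) (trans eq (tip′ d))))
    rainbow (base-center c) (center-base d) eq = inj₂ (cong suc (trans (sym (tip′ c)) (trans eq (tip d))) , refl)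
    rainbow (base-center c) (base-center d) eq = inj₁ (cong suc (trans (sym (tip′ c)) (trans eq (tip′ d))) , refl)

-- The number `n + n + ⌊ n /2⌋` is ⌊5n/2⌋.
kipas-bound : ∀ n → 2 ≤ n → GallaiRamseyBound 3 (star 3) (kipas n) (n + n + ⌊ n /2⌋)
kipas-bound n 2≤n m large χ exact
  with any? (λ v → all? λ c → any? λ x → ColourGraphs.E? χ c v x)
... | yes (v , leaf) = inj₁ (allColours⇒rainbow χ v leaf)
-- The existence of a monochromatic kipas is decidable, so it may be refuted by contradiction.
... | no ¬all = inj₂ (decidable-stable (∃-monochromatic? χ {kipas n} (cone-adj? {path n} (path-adj? n))) λ kipasFree →
        let p , q , r , d , q≤p , r≤q = sort₃ size
        in KipasFree.Sorted.absurd n 2≤n kipasFree d q≤p r≤q large exact)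
  where
  open ColourGraphs χ
  miss : ∀ v → ∃[ c ] ¬ (∃[ x ] E c v x)
  miss v = ¬∀⟶∃¬ 3 _ (λ c → any? (E? c v)) (λ leaf → ¬all (v , leaf))
  open Classes (λ v → proj₁ (miss v)) (λ {x} {y} x≢y eq → proj₂ (miss x) (y , x≢y , eq))

-- The lower bound

⌊n+n/2⌋≡n : ∀ n → ⌊ n + n /2⌋ ≡ n
⌊n+n/2⌋≡n zero    = refl
⌊n+n/2⌋≡n (suc n) rewrite +-suc n n = cong suc (⌊n+n/2⌋≡n n)

⌊1+n+n/2⌋≡n : ∀ n → ⌊ suc (n + n) /2⌋ ≡ n
⌊1+n+n/2⌋≡n zero    = refl
⌊1+n+n/2⌋≡n (suc n) rewrite +-suc n n = cong suc (⌊1+n+n/2⌋≡n n)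

-- The extremal colouring: n vertices spanning a clique of colour 2, joined in
-- colour 0 to a further vertices, which fall into three classes: inside the
-- classes the colour is 0 and between them it is 1. By few, any two of the
-- classes together have fewer than n vertices.
module Extremal (n h a : ℕ) (2≤n : 2 ≤ n) (2h≤n : h + h ≤ n) (1≤h : 1 ≤ h) (2≤a : 2 ≤ a) (a≤3h : a ≤ h * 3)
  (few : ∀ (q : Fin h) {r c : Fin 3} (r≢c : r ≢ c) → toℕ (combine q c) < a → suc (toℕ (combine q (punchOut r≢c))) < n) where

  Vertex : Set
  Vertex = Fin n ⊎ (Fin h × Fin 3)

  -- The vertices outside the clique are dealt to the three classes in turn: number 3q + c becomes
  -- member `q` of class `c`. Hence no class has more than `h` members.
  τ : Fin (n + a) → Vertex
  τ x = Sum.map₂ (λ t → remQuot 3 (inject≤ t a≤3h)) (splitAt n x)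

  combine-τ : ∀ {x q c} → τ x ≡ inj₂ (q , c) → ∃[ t ] (n ↑ʳ t ≡ x × combine q c ≡ inject≤ t a≤3h)
  combine-τ {x} eq with splitAt n x in eqx
  combine-τ {x} refl | inj₂ t = t , splitAt⁻¹-↑ʳ eqx , combine-remQuot {h} 3 (inject≤ t a≤3h)

  base-τ : ∀ {x i} → τ x ≡ inj₁ i → i ↑ˡ a ≡ x
  base-τ {x} eq with splitAt n x in eqx
  base-τ refl | inj₁ i = splitAt⁻¹-↑ˡ eqx

  τ-injective : ∀ {x y} → τ x ≡ τ y → x ≡ y
  τ-injective {x} {y} eq with τ x in eqx
  ... | inj₂ (q , c) =
    let t , t≡ , e = combine-τ eqx ; u , u≡ , e′ = combine-τ (sym eq)
    in trans (sym t≡) (trans (cong (n ↑ʳ_) (inject≤-injective _ _ t u (trans (sym e) e′))) u≡)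
  ... | inj₁ i = trans (sym (base-τ eqx)) (base-τ (sym eq))

  bounded : ∀ {x q c} → τ x ≡ inj₂ (q , c) → toℕ (combine q c) < a
  bounded eq = let t , _ , e = combine-τ eq in
    ≤-trans (s≤s (≤-reflexive (trans (cong toℕ e) (toℕ-inject≤ t a≤3h)))) (toℕ<n t)

  shade : {P : Set} → Dec P → Fin 3
  shade (yes _) = zero
  shade (no _)  = suc zero

  hue : Vertex → Vertex → Fin 3
  hue (inj₁ _)       (inj₁ _)       = suc (suc zero)
  hue (inj₁ _)       (inj₂ _)       = zero
  hue (inj₂ _)       (inj₁ _)       = zero
  hue (inj₂ (_ , c)) (inj₂ (_ , d)) = shade (c ≟ᶠ d)

  hue-sym : ∀ u v → hue u v ≡ hue v u
  hue-sym (inj₁ _)       (inj₁ _)       = refl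
  hue-sym (inj₁ _)       (inj₂ _)       = refl
  hue-sym (inj₂ _)       (inj₁ _)       = refl
  hue-sym (inj₂ (_ , c)) (inj₂ (_ , d)) with c ≟ᶠ d | d ≟ᶠ c
  ... | yes _    | yes _    = refl
  ... | no  _    | no  _    = refl
  ... | yes refl | no  d≢c  = contradiction refl d≢c
  ... | no  c≢d  | yes refl = contradiction refl c≢d

  χ : Coloring 3 (n + a)
  χ = record { color = λ x y → hue (τ x) (τ y) ; color-sym = λ x y → hue-sym (τ x) (τ y) }

  private
    base : Fin n → Fin (n + a)
    base i = i ↑ˡ a

    τ-base : ∀ i → τ (base i) ≡ inj₁ i
    τ-base i rewrite splitAt-↑ˡ n i a = refl

    rim : ∀ c → toℕ c < 2 → ∃[ x ] ∃[ q ] τ x ≡ inj₂ (q , c)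
    rim c c<2 = n ↑ʳ t , q , trans (cong (Sum.map₂ _) (splitAt-↑ʳ n a t))
        (cong inj₂ (trans (cong (remQuot 3) t≡) (remQuot-combine q c)))
      where
      q : Fin h
      q = fromℕ< 1≤h
      t : Fin a
      t = fromℕ< (≤-trans c<2 2≤a)
      t≡ : inject≤ t a≤3h ≡ combine q c
      t≡ = toℕ-injective (begin
        toℕ (inject≤ t a≤3h)       ≡⟨ toℕ-inject≤ t a≤3h ⟩
        toℕ t                      ≡⟨ toℕ-fromℕ< (≤-trans c<2 2≤a) ⟩
        toℕ c                      ≡⟨ cong (λ k → 3 * k + toℕ c) (toℕ-fromℕ< 1≤h) ⟨
        3 * toℕ q + toℕ c          ≡⟨ toℕ-combine q c ⟨
        toℕ (combine q c)          ∎)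
        where open ≡-Reasoning

    apart : ∀ {x y u v} → τ x ≡ u → τ y ≡ v → u ≢ v → x ≢ y
    apart refl refl u≢v refl = u≢v refl

  exact : Exact χ
  exact zero = let x , _ , eq = rim zero (s≤s z≤n) ; b = fromℕ< (<⇒≤ 2≤n) in
    base b , x , apart (τ-base b) eq (λ ()) , cong₂ hue (τ-base b) eq
  exact (suc zero) = let x , _ , eq = rim zero (s≤s z≤n) ; y , _ , eq′ = rim (suc zero) ≤-refl in
    x , y , apart eq eq′ (λ ()) , cong₂ hue eq eq′
  exact (suc (suc zero)) = base b₀ , base b₁ , apart (τ-base b₀) (τ-base b₁) (b₀≢b₁ ∘ inj₁-injective) ,
    cong₂ hue (τ-base b₀) (τ-base b₁)
    where
    b₀ b₁ : Fin n
    b₀ = fromℕ< (<⇒≤ 2≤n)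
    b₁ = fromℕ< 2≤n
    b₀≢b₁ : b₀ ≢ b₁
    b₀≢b₁ eq = contradiction (trans (sym (toℕ-fromℕ< (<⇒≤ 2≤n))) (trans (cong toℕ eq) (toℕ-fromℕ< 2≤n))) λ ()

  missing-hue : ∀ u → ∃[ c ] (∀ v → c ≢ hue u v)
  missing-hue (inj₁ _)       = suc zero , λ { (inj₁ _) () ; (inj₂ _) () }
  missing-hue (inj₂ (_ , c)) = suc (suc zero) , λ { (inj₁ _) () ; (inj₂ (_ , d)) → shade-avoids (c ≟ᶠ d) }
    where
    shade-avoids : ∀ {P : Set} (P? : Dec P) → suc (suc zero) ≢ shade P?
    shade-avoids (yes _) ()
    shade-avoids (no _)  ()

  -- A colour is missing at the centre, so the three edges of a rainbow star would need distinct
  -- colours among the other two.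
  no-rainbow : ¬ ∃ (Rainbow χ (star 3))
  no-rainbow (φ , rainbow) with missing-hue (τ (Injection.to φ zero))
  ... | c , avoids = contradiction (injective⇒≤ leaf-injective) λ { (s≤s (s≤s ())) }
    where
    leaf : Fin 3 → Fin 2
    leaf i = punchOut (avoids (τ (Injection.to φ (suc i))))
    leaf-injective : ∀ {i j} → leaf i ≡ leaf j → i ≡ j
    leaf-injective {i} {j} eq with rainbow (center-base i) (center-base j) (punchOut-injective (avoids _) (avoids _) eq)
    ... | inj₁ (_ , refl) = refl

  data Shaded : Vertex → Vertex → Set where
    inside : ∀ {q q′ c} → Shaded (inj₂ (q , c)) (inj₂ (q′ , c))
    inOut  : ∀ {s i} → Shaded (inj₂ s) (inj₁ i)
    outIn  : ∀ {i s} → Shaded (inj₁ i) (inj₂ s)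

  shaded-class : ∀ {q q′ c d} → Shaded (inj₂ (q , c)) (inj₂ (q′ , d)) → c ≡ d
  shaded-class inside = refl

  hue≡0 : ∀ u v → hue u v ≡ zero → Shaded u v
  hue≡0 (inj₁ _)       (inj₂ _)       _ = outIn
  hue≡0 (inj₂ _)       (inj₁ _)       _ = inOut
  hue≡0 (inj₂ (_ , c)) (inj₂ (_ , d)) eq with yes refl ← c ≟ᶠ d = inside

  hue≡1 : ∀ {q c} v → hue (inj₂ (q , c)) v ≡ suc zero → ∃[ q′ ] ∃[ d ] (v ≡ inj₂ (q′ , d) × c ≢ d)
  hue≡1 {c = c} (inj₂ (q′ , d)) eq with c ≟ᶠ d
  ... | no c≢d = q′ , d , refl , c≢d

  hue≡2 : ∀ {i} v → hue (inj₁ i) v ≡ suc (suc zero) → ∃[ j ] v ≡ inj₁ j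
  hue≡2 (inj₁ j) _ = j , refl

  module NoKipas (φ : Copy (kipas n) (n + a)) where

    at : Fin (suc n) → Fin (n + a)
    at = Injection.to φ

    same : ∀ {i j} {u : Vertex} → τ (at i) ≡ u → τ (at j) ≡ u → i ≡ j
    same eq eq′ = Injection.injective φ (τ-injective (trans eq (sym eq′)))

    clique-free : (∀ i → ∃[ b ] τ (at i) ≡ inj₁ b) → ⊥
    clique-free f = <⇒≱ ≤-refl (injective⇒≤ {f = λ i → proj₁ (f i)}
      λ {i} {j} eq → same (proj₂ (f i)) (trans (proj₂ (f j)) (cong inj₁ (sym eq))))

    -- For colour 1 and a centre in class `r`. The members of the two other classes are numbered in
    -- turn, and by `few` all numbers are below `n ∸ 1`, which leaves no room for the `n` vertices
    -- of the path.
    other-classes : ∀ r → (∀ i → ∃[ q ] ∃[ c ] (τ (at (suc i)) ≡ inj₂ (q , c) × r ≢ c)) → ⊥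
    other-classes r f = <⇒≱ (n∸1<n (<⇒≤ 2≤n)) (injective⇒≤ {f = index} index-injective)
      where
      n∸1<n : ∀ {k} → 1 ≤ k → k ∸ 1 < k
      n∸1<n (s≤s _) = ≤-refl
      code : ∀ i → Fin (h * 2)
      code i = let q , c , eq , r≢c = f i in combine q (punchOut r≢c)
      small : ∀ i → toℕ (code i) < n ∸ 1
      small i = let q , c , eq , r≢c = f i in m+n≤o⇒m≤o∸n _ (subst (_≤ n) (+-comm 1 _) (few q r≢c (bounded eq)))
      index : Fin n → Fin (n ∸ 1)
      index i = fromℕ< (small i)
      index-injective : ∀ {i j} → index i ≡ index j → i ≡ j
      index-injective {i} {j} eq =
        let q  , c  , e  , r≢c  = f i
            q′ , c′ , e′ , r≢c′ = f j
            codes≡ = toℕ-injective (fromℕ<-injective _ _ (small i) (small j) eq)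
            q≡ , p≡ = combine-injective q (punchOut r≢c) q′ (punchOut r≢c′) codes≡
        in sucᶠ-injective (same e (trans e′ (cong inj₂ (sym (cong₂ _,_ q≡ (punchOut-injective r≢c r≢c′ p≡))))))

    -- For colour 0 and a centre in the clique: the path stays outside the clique, so its colour
    -- keeps it in one class, which has at most `h < n` vertices.
    constant-class : (∀ i → ∃[ s ] τ (at (suc i)) ≡ inj₂ s) →
      (∀ {i j} → suc (toℕ i) ≡ toℕ j → Shaded (τ (at (suc i))) (τ (at (suc j)))) → ⊥
    constant-class f step = <⇒≱ h<n (injective⇒≤ {f = λ i → proj₁ (proj₁ (f i))} λ {i} {j} eq →
        sucᶠ-injective (same (proj₂ (f i)) (trans (proj₂ (f j)) (cong inj₂ (sym (cong₂ _,_ eq (all-equal class class-step i j)))))))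
      where
      h<n : h < n
      h<n = ≤-trans (+-monoˡ-≤ h 1≤h) 2h≤n
      class : Fin n → Fin 3
      class i = proj₂ (proj₁ (f i))
      class-step : ∀ {i j} → suc (toℕ i) ≡ toℕ j → class i ≡ class j
      class-step {i} {j} e = shaded-class (subst₂ Shaded (proj₂ (f i)) (proj₂ (f j)) (step e))
      constant : ∀ {k} (g : Fin (suc k) → Fin 3) → (∀ {i j} → suc (toℕ i) ≡ toℕ j → g i ≡ g j) → ∀ i → g i ≡ g zero
      constant g g-step zero = refl
      constant {suc k} g g-step (suc i) =
        trans (constant (g ∘ suc) (λ e → g-step (cong suc e)) i) (sym (g-step refl))
      all-equal : ∀ {k} (g : Fin k → Fin 3) → (∀ {i j} → suc (toℕ i) ≡ toℕ j → g i ≡ g j) → ∀ i j → g i ≡ g j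
      all-equal {suc k} g g-step i j = trans (constant g g-step i) (sym (constant g g-step j))

    -- No two consecutive vertices of the path are in the clique, so its h
    -- disjoint pairs of consecutive vertices and the centre give h + 1
    -- vertices of one class.
    bipartite : ∀ {q r} → τ (at zero) ≡ inj₂ (q , r) →
      (∀ i → Shaded (inj₂ (q , r)) (τ (at (suc i)))) →
      (∀ {i j} → suc (toℕ i) ≡ toℕ j → Shaded (τ (at (suc i))) (τ (at (suc j)))) → ⊥
    bipartite {q} {r} centre spoke step = <⇒≱ ≤-refl (injective⇒≤ {f = row} row-injective)
      where
      InClass : Fin n → Set
      InClass k = ∃[ q′ ] τ (at (suc k)) ≡ inj₂ (q′ , r)
      inClass : ∀ k → InClass k ⊎ ∃[ b ] τ (at (suc k)) ≡ inj₁ b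
      inClass k with τ (at (suc k)) | spoke k
      ... | inj₂ (q′ , _) | inside = inj₁ (q′ , refl)
      ... | inj₁ b        | _      = inj₂ (b , refl)
      -- The pair consists of the path vertices 2i and 2i + 1. Halving the index recovers `i`, which
      -- makes the chosen vertices distinct.
      pair : ∀ (i : Fin h) → ∃[ k ] (⌊ toℕ k /2⌋ ≡ toℕ i × InClass k)
      pair i = choose (inClass k₀) (inClass k₁)
        where
        2i+1<n : suc (toℕ i + toℕ i) < n
        2i+1<n = ≤-trans (≤-reflexive (cong suc (sym (+-suc (toℕ i) (toℕ i))))) (≤-trans (+-mono-≤ (toℕ<n i) (toℕ<n i)) 2h≤n)
        k₀ k₁ : Fin n
        k₀ = fromℕ< (<⇒≤ 2i+1<n)
        k₁ = fromℕ< 2i+1<n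
        k₀≡ : toℕ k₀ ≡ toℕ i + toℕ i
        k₀≡ = toℕ-fromℕ< (<⇒≤ 2i+1<n)
        k₁≡ : toℕ k₁ ≡ suc (toℕ i + toℕ i)
        k₁≡ = toℕ-fromℕ< 2i+1<n
        choose : InClass k₀ ⊎ (∃[ b ] τ (at (suc k₀)) ≡ inj₁ b) → InClass k₁ ⊎ (∃[ b ] τ (at (suc k₁)) ≡ inj₁ b) →
          ∃[ k ] (⌊ toℕ k /2⌋ ≡ toℕ i × InClass k)
        choose (inj₁ c) _        = k₀ , trans (cong ⌊_/2⌋ k₀≡) (⌊n+n/2⌋≡n (toℕ i)) , c
        choose (inj₂ _) (inj₁ c) = k₁ , trans (cong ⌊_/2⌋ k₁≡) (⌊1+n+n/2⌋≡n (toℕ i)) , c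
        choose (inj₂ (_ , e)) (inj₂ (_ , e′)) with subst₂ Shaded e e′ (step (trans (cong suc k₀≡) (sym k₁≡)))
        ... | ()
      row : Fin (suc h) → Fin h
      row zero    = q
      row (suc i) = proj₁ (proj₂ (proj₂ (pair i)))
      member : ∀ i → ∃[ j ] τ (at j) ≡ inj₂ (row i , r)
      member zero    = zero , centre
      member (suc i) = let k , _ , q′ , e = pair i in suc k , e
      recover : ∀ i j → proj₁ (member i) ≡ proj₁ (member j) → i ≡ j
      recover zero    zero    _  = refl
      recover (suc i) (suc j) eq = let k , e , _ = pair i ; k′ , e′ , _ = pair j in
        cong suc (toℕ-injective (trans (sym e) (trans (cong (⌊_/2⌋ ∘ toℕ) (sucᶠ-injective eq)) e′)))
      row-injective : ∀ {i j} → row i ≡ row j → i ≡ j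
      row-injective {i} {j} eq = recover i j (same (proj₂ (member i)) (trans (proj₂ (member j)) (cong (λ q → inj₂ (q , r)) (sym eq))))

  -- Three colours and two places of the centre give six cases. In two of them the centre misses the
  -- colour; the others are the four lemmas of `NoKipas`.
  no-kipas : ¬ ∃ (Monochromatic χ (kipas n))
  no-kipas (φ , c , mono) = byColour c (τ (at zero)) refl (λ i → mono (center-base i)) λ e → mono (base-base (inj₁ e))
    where
    open NoKipas φ
    byColour : ∀ c u → τ (at zero) ≡ u →
      (∀ i → hue u (τ (at (suc i))) ≡ c) →
      (∀ {i j} → suc (toℕ i) ≡ toℕ j → hue (τ (at (suc i))) (τ (at (suc j))) ≡ c) → ⊥
    byColour zero (inj₁ b) _ spoke step = constant-class outside (λ e → hue≡0 _ _ (step e))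
      where
      shaded-out : ∀ {v} → Shaded (inj₁ b) v → ∃[ s ] v ≡ inj₂ s
      shaded-out outIn = _ , refl
      outside : ∀ i → ∃[ s ] τ (at (suc i)) ≡ inj₂ s
      outside i = shaded-out (hue≡0 _ (τ (at (suc i))) (spoke i))
    byColour zero (inj₂ (q , r)) eq spoke step =
      bipartite eq (λ i → hue≡0 _ (τ (at (suc i))) (spoke i)) (λ e → hue≡0 _ _ (step e))
    byColour (suc zero) (inj₁ b) _ spoke _ =
      proj₂ (missing-hue (inj₁ b)) (τ (at (suc (fromℕ< 2≤n)))) (sym (spoke (fromℕ< 2≤n)))
    byColour (suc zero) (inj₂ (q , r)) _ spoke _ =
      other-classes r λ i → hue≡1 (τ (at (suc i))) (spoke i)
    byColour (suc (suc zero)) (inj₁ b) eq spoke _ = clique-free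
      λ { zero → b , eq ; (suc i) → hue≡2 {b} (τ (at (suc i))) (spoke i) }
    byColour (suc (suc zero)) (inj₂ s) _ spoke _ =
      proj₂ (missing-hue (inj₂ s)) (τ (at (suc (fromℕ< 2≤n)))) (sym (spoke (fromℕ< 2≤n)))

  no-bound : ∀ {M} → M ≤ n + a → ¬ GallaiRamseyBound 3 (star 3) (kipas n) M
  no-bound M≤ bound = Sum.[ no-rainbow , no-kipas ] (bound (n + a) M≤ χ exact)

-- Odd and even n

2*≡ : ∀ h → ⌊ h * 2 /2⌋ ≡ h
2*≡ zero    = refl
2*≡ (suc h) = cong suc (2*≡ h)

1+2*≡ : ∀ h → ⌊ suc (h * 2) /2⌋ ≡ h
1+2*≡ zero    = refl
1+2*≡ (suc h) = cong suc (1+2*≡ h)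

5n/2-even : ∀ h → (5 * (h * 2)) / 2 ≡ h * 2 + h * 2 + h
5n/2-even h = trans (cong (_/ 2) (rearrange h)) (m*n/n≡m (h * 2 + h * 2 + h) 2)
  where
  rearrange : ∀ h → 5 * (h * 2) ≡ (h * 2 + h * 2 + h) * 2
  rearrange = solve-∀

5n/2-odd : ∀ h → (5 * suc (h * 2)) / 2 ≡ suc (h * 2) + suc (h * 2) + h
5n/2-odd h = trans (cong (_/ 2) (rearrange h))
  (trans (+-distrib-/-∣ʳ 1 {k * 2} {2} (divides-refl k)) (m*n/n≡m k 2))
  where
  k : ℕ
  k = suc (h * 2) + suc (h * 2) + h
  rearrange : ∀ h → 5 * suc (h * 2) ≡ 1 + (suc (h * 2) + suc (h * 2) + h) * 2
  rearrange = solve-∀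

-- For n = 2h + 1 all three classes can have `h` members: two of them together have 2h = n - 1
-- vertices.
odd-lower : ∀ h {M} → 1 ≤ h → GallaiRamseyBound 3 (star 3) (kipas (suc (h * 2))) M →
  suc (h * 2) + suc (h * 2) + h ≤ M
odd-lower h {M} 1≤h bound = ≮⇒≥ λ M< → Extremal.no-bound (suc (h * 2)) h (h * 3)
    (s≤s (≤-trans 1≤h (m≤m*n h 2))) (≤-trans (≤-reflexive (h+h≡ h)) (n≤1+n _)) 1≤h
    (*-mono-≤ 1≤h (s≤s (s≤s (z≤n {1})))) ≤-refl
    (λ q r≢c _ → s≤s (toℕ<n (combine q (punchOut r≢c))))
    (s≤s⁻¹ (subst (suc M ≤_) (total h) M<)) bound
  where
  h+h≡ : ∀ h → h + h ≡ h * 2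
  h+h≡ = solve-∀
  total : ∀ h → suc (h * 2) + suc (h * 2) + h ≡ suc (suc (h * 2) + h * 3)
  total = solve-∀

-- For n = 2k + 2, two classes with ⌊n/2⌋ = k + 1 members would have `n` vertices together. So only
-- class 0 gets k + 1 members and the others get `k`, which costs two vertices against three full
-- classes.
even-lower : ∀ k {M} → 1 ≤ k → GallaiRamseyBound 3 (star 3) (kipas (suc k * 2)) M →
  (suc k * 2 + suc k * 2 + suc k) ∸ 1 ≤ M
even-lower k {M} 1≤k bound = ≮⇒≥ λ M< → Extremal.no-bound (suc k * 2) (suc k) (1 + k * 3)
    (s≤s (s≤s z≤n)) (≤-reflexive (h+h≡ (suc k))) (s≤s z≤n) (s≤s (≤-trans 1≤k (m≤m*n k 3)))
    (s≤s (≤-trans (n≤1+n _) (n≤1+n _)))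
    few (s≤s⁻¹ (subst (suc M ≤_) (total k) M<)) bound
  where
  h+h≡ : ∀ h → h + h ≡ h * 2
  h+h≡ = solve-∀
  total : ∀ k → suc (k * 2) + suc k * 2 + suc k ≡ suc (suc k * 2 + (1 + k * 3))
  total = solve-∀
  few : ∀ (q : Fin (suc k)) {r c : Fin 3} (r≢c : r ≢ c) → toℕ (combine q c) < 1 + k * 3 →
    suc (toℕ (combine q (punchOut r≢c))) < suc k * 2
  few q {zero}  {zero}  r≢c _ = contradiction refl r≢c
  -- Class 0 comes first among any two classes, so its members get the even numbers 2q, of which the
  -- last is 2k.
  few q {suc r} {zero}  r≢c _ = s≤s (s≤s (begin
    toℕ (combine q (zero {1}))   ≡⟨ toℕ-combine q (zero {1}) ⟩
    2 * toℕ q + 0                ≡⟨ +-identityʳ (2 * toℕ q) ⟩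
    2 * toℕ q                    ≤⟨ *-monoʳ-≤ 2 (s≤s⁻¹ (toℕ<n q)) ⟩
    2 * k                        ≡⟨ *-comm 2 k ⟩
    k * 2                        ∎))
    where open ≤-Reasoning
  -- In the classes 1 and 2 the bound on 3q + c leaves only `q < k`.
  few q {r} {suc c} r≢c lt = s≤s (s≤s (begin
    toℕ (combine q (punchOut r≢c))   ≡⟨ toℕ-combine q (punchOut r≢c) ⟩
    2 * toℕ q + toℕ (punchOut r≢c)   ≤⟨ +-monoʳ-≤ (2 * toℕ q) (<⇒≤ (toℕ<n (punchOut r≢c))) ⟩
    2 * toℕ q + 2                    ≡⟨ +-comm (2 * toℕ q) 2 ⟩
    2 + 2 * toℕ q                    ≡⟨ *-suc 2 (toℕ q) ⟨
    2 * suc (toℕ q)                  ≤⟨ *-monoʳ-≤ 2 q<k ⟩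
    2 * k                            ≡⟨ *-comm 2 k ⟩
    k * 2                            ∎))
    where
    open ≤-Reasoning
    q<k : toℕ q < k
    q<k = *-cancelˡ-< 3 (toℕ q) k (begin-strict
      3 * toℕ q                      ≤⟨ m≤m+n (3 * toℕ q) (toℕ c) ⟩
      3 * toℕ q + toℕ c              <⟨ s≤s⁻¹ (≤-trans (s≤s (≤-reflexive (trans (sym (+-suc (3 * toℕ q) (toℕ c)))
                                                                                 (sym (toℕ-combine q (suc c)))))) lt) ⟩
      k * 3                          ≡⟨ *-comm k 3 ⟩
      3 * k                          ∎)

kipas-minimum-odd : ∀ h → 1 ≤ h →
  IsGallaiRamseyNumber 3 (star 3) (kipas (suc (h * 2))) ((5 * suc (h * 2)) / 2)
kipas-minimum-odd h 1≤h rewrite 5n/2-odd h =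
  subst (λ k → GallaiRamseyBound 3 (star 3) (kipas n) (n + n + k)) (1+2*≡ h)
    (kipas-bound n (s≤s (≤-trans 1≤h (m≤m*n h 2)))) ,
  λ M → odd-lower h 1≤h
  where
  n : ℕ
  n = suc (h * 2)

kipas-minimum-even : ∀ k → 1 ≤ k → let n = suc k * 2 in
  ∃[ N ] (IsGallaiRamseyNumber 3 (star 3) (kipas n) N × ((5 * n) / 2) ∸ 1 ≤ N × N ≤ (5 * n) / 2)
kipas-minimum-even k 1≤k rewrite 5n/2-even (suc k) =
  decide (boundAt? 3 N {star 3} {kipas n} (cone-adj? {edgeless 3} (edgeless-adj? 3)) (cone-adj? {path n} (path-adj? n)))
  where
  n N : ℕ
  n = suc k * 2
  N = (n + n + suc k) ∸ 1
  bound : GallaiRamseyBound 3 (star 3) (kipas n) (suc N)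
  bound = subst (λ k → GallaiRamseyBound 3 (star 3) (kipas n) (n + n + k)) (2*≡ (suc k)) (kipas-bound n (s≤s (s≤s z≤n)))
  -- The upper bound covers all orders above `N`, and the lower bound excludes all values below `N`,
  -- so the colourings of order `N` alone decide between `N` and `suc N`.
  decide : Dec (BoundAt 3 (star 3) (kipas n) N) →
    ∃[ M ] (IsGallaiRamseyNumber 3 (star 3) (kipas n) M × N ≤ M × M ≤ suc N)
  decide (yes b) = N , (boundN , λ M → even-lower k 1≤k) , ≤-refl , n≤1+n N
    where
    boundN : GallaiRamseyBound 3 (star 3) (kipas n) N
    boundN m N≤m with m≤n⇒m<n∨m≡n N≤m
    ... | inj₁ N<m  = bound m N<m
    ... | inj₂ refl = b
  decide (no ¬b) = suc N , (bound , λ M P → ≰⇒> λ M≤N → ¬b (P N M≤N)) , n≤1+n N , ≤-refl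

theorem1p10 : ∀ (n : ℕ) → 5 ≤ n →
    (2 ∤ n → IsGallaiRamseyNumber 3 (star 3) (kipas n) ((5 * n) / 2)) ×
    (2 ∣ n → ∃[ N ] (IsGallaiRamseyNumber 3 (star 3) (kipas n) N × ((5 * n) / 2) ∸ 1 ≤ N × N ≤ (5 * n) / 2))
theorem1p10 n 5≤n = odd n 5≤n , even n 5≤n
  where
  odd : ∀ n → 5 ≤ n → 2 ∤ n → IsGallaiRamseyNumber 3 (star 3) (kipas n) ((5 * n) / 2)
  odd n 5≤n 2∤n with n / 2 | n % 2 | m≡m%n+[m/n]*n n 2 | m%n<n n 2
  ... | h     | 0           | refl | _ = contradiction (divides-refl h) 2∤n
  ... | suc h | 1           | refl | _ = kipas-minimum-odd (suc h) (s≤s z≤n)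
  ... | zero  | 1           | refl | _ = contradiction 5≤n λ { (s≤s ()) }
  ... | _     | suc (suc _) | _    | s≤s (s≤s ())
  even : ∀ n → 5 ≤ n → 2 ∣ n →
    ∃[ N ] (IsGallaiRamseyNumber 3 (star 3) (kipas n) N × ((5 * n) / 2) ∸ 1 ≤ N × N ≤ (5 * n) / 2)
  even _ 5≤n (divides-refl (suc (suc k))) = kipas-minimum-even (suc k) (s≤s z≤n)
  even _ 5≤n (divides-refl (suc zero))    = contradiction 5≤n λ { (s≤s (s≤s ())) }
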